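{- The algorithm $\mathrm{LWF}$ is $4$-speed $O(1)$-competitive for minimizing total (equivalently, average) flow time; that is, there is an absolute constant $C$ such that for every finite request sequence $\mathrm{LWF}_4\le C\cdot \mathrm{OPT}$.
   Context: Broadcast scheduling, discrete time. There are $n$ unit-sized pages. $J_{p,i}$ denotes the $i$-th request for page $p\in\{1,\dots,n\}$; it arrives at an integer time $a_{p,i}$. At each integer time $t$ the following happen in this order: the scheduler chooses pages and broadcasts them, and all outstanding requests for these pages are satisfied and get finish time $t$; then new requests arrive. Hence a request arriving at time $t$ is not satisfied by a broadcast at time $t$, and the finish time $f_{p,i}$ of $J_{p,i}$ is the earliest integer time strictly after $a_{p,i}$ at which $p$ is broadcast. A schedule with integer speed $s$ broadcasts at most $s$ pages at each integer time. The total flow time of a schedule is $\sum_{p}\sum_i (f_{p,i}-a_{p,i})$. $\mathrm{OPT}$ denotes the minimum total flow time of a $1$-speed offline schedule for the request sequence. Algorithm $\mathrm{LWF}_s$: at each integer time $t$, letting $U(t)$ be the set of requests that have arrived and are unsatisfied at time $t$, broadcast the $s$ pages $p$ with the largest waiting times $\sum_{J_{p,i}\in U(t)}(t-a_{p,i})$ (ties broken arbitrarily; if fewer than $s$ pages have outstanding requests, all of these are broadcast). $\mathrm{LWF}_s$ also denotes the total flow time of its schedule. -}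

module Defs where

open import Data.Bool.Base using (if_then_else_)
open import Data.Fin.Base using (Fin)
open import Data.Fin.Subset using (Subset; _∈_; _∉_; ∣_∣)
open import Data.Fin.Subset.Properties using (_∈?_)
open import Data.Nat.Base using (ℕ; _∸_; _≤_; _<_)
open import Data.Nat.Properties using (_<?_; allUpTo?; +-*-semiring)
open import Data.Product.Base using (_×_; ∃-syntax; Σ-syntax)
open import Relation.Binary.PropositionalEquality using (_≡_)
open import Relation.Nullary.Decidable using (Dec; does; ¬?; _×-dec_; _→-dec_)

open import Algebra.Properties.Semiring.Sum +-*-semiring public
  using (sum; sum-syntax)

-- A finite request sequence for n unit-sized pages.  Time is discrete and
-- starts at 0.  Several requests for one page may arrive simultaneously, and
-- the numbering of the requests need not follow the arrival order.
record Requests (n : ℕ) : Set where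
  field
    count   : Fin n → ℕ
    arrival : (p : Fin n) → Fin (count p) → ℕ

open Requests public

Schedule : ℕ → Set
Schedule n = ℕ → Subset n

HasSpeed : ∀ {n} → ℕ → Schedule n → Set
HasSpeed s σ = ∀ t → ∣ σ t ∣ ≤ s

module _ {n : ℕ} (R : Requests n) where

  record IsFinishTime (σ : Schedule n) (p : Fin n) (i : Fin (count R p))
                      (f : ℕ) : Set where
    field
      after     : arrival R p i < f
      broadcast : p ∈ σ f
      earliest  : ∀ {u} → arrival R p i < u → p ∈ σ u → f ≤ u

  -- A schedule that leaves some request unsatisfied forever has no total flow
  -- time in this sense (informally, it is infinite).
  TotalFlow : Schedule n → ℕ → Set
  TotalFlow σ v =
    Σ[ f ∈ ((p : Fin n) → Fin (count R p) → ℕ) ]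
      (∀ p i → IsFinishTime σ p i (f p i)) ×
      v ≡ ∑[ p < n ] ∑[ i < count R p ] (f p i ∸ arrival R p i)

  record IsOPT (v : ℕ) : Set where
    field
      attained : ∃[ σ ] HasSpeed 1 σ × TotalFlow σ v
      minimal  : ∀ σ w → HasSpeed 1 σ → TotalFlow σ w → v ≤ w

  -- Membership in U(t), as seen by the scheduler when it chooses the
  -- broadcasts of time t: requests arriving at t come only afterwards, hence
  -- the strict inequality, and only broadcasts before t matter.
  Outstanding : Schedule n → ℕ → (p : Fin n) → Fin (count R p) → Set
  Outstanding σ t p i =
    arrival R p i < t × (∀ {u} → u < t → arrival R p i < u → p ∉ σ u)

  outstanding? : ∀ σ t p i → Dec (Outstanding σ t p i)
  outstanding? σ t p i =
    (arrival R p i <? t) ×-dec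
    allUpTo? (λ u → (arrival R p i <? u) →-dec ¬? (p ∈? σ u)) t

  waitingTime : Schedule n → ℕ → Fin n → ℕ
  waitingTime σ t p =
    ∑[ i < count R p ]
      (if does (outstanding? σ t p i) then t ∸ arrival R p i else 0)

  -- σ is a possible run of LWF with speed s; every way of breaking ties is
  -- allowed.  The first three fields say that σ t consists of
  -- min(s, number of pages with outstanding requests) such pages.
  record IsLWF (s : ℕ) (σ : Schedule n) : Set where
    field
      speed   : HasSpeed s σ
      pending : ∀ {t p} → p ∈ σ t → ∃[ i ] Outstanding σ t p i
      full    : ∀ {t p i} → ∣ σ t ∣ < s → Outstanding σ t p i → p ∈ σ t
      longest : ∀ {t p q} → p ∈ σ t → q ∉ σ t →
                waitingTime σ t q ≤ waitingTime σ t p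

{-# OPTIONS --safe #-}

-- For a broadcast (t , p) of LWF let F be the waiting time of p at t, so that the
-- flow of LWF is ΣF.  Let o be the last time before t at which OPT broadcasts p,
-- and let X ≤ F be the part of F due to requests that arrived before o.  OPT
-- serves all other requests no earlier than LWF does, so LWF ≤ OPT + ΣX, and it
-- suffices that ΣX ≤ (1 − ε) ΣF.
--
-- Between o and t the waiting time of p is at least a linear ramp from 0 at o − 1
-- to X at t, and LWF does not broadcast p; so at each of these times it makes four
-- broadcasts whose F is at least the value of the ramp.  Fix a level y (measured in
-- units of 1/200) and let U be the set of times at which some ramp reaches y.  In
-- a maximal run of R consecutive times of U there are 4R broadcasts with F ≥ y.
-- A broadcast with X ≥ 2y whose ramp reaches y in this run has its o in the run
-- or among the R times before it.  The o are distinct, as OPT has speed 1, so there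
-- are at most 2R such broadcasts.  Summing over y gives ΣX ≤ ΣF: just not enough.
--
-- The gain comes from replacing the factor 2 by a mixture of the five factors
-- 200/(100 − i), i < 5.  This costs only second order in the perturbation, whereas
-- a broadcast whose o is extremal for one of the factors must take place in the
-- last 1/52 of the run.  The extremal o of different factors are distinct, so they
-- would need five times R/52 broadcasts there, but LWF makes only four times R/52.
-- Rounding errors are absorbed by giving the factor 2 an extra weight of 12 and by
-- the broadcast right after the run, whose own F is also at least y.
module Submission where

open import Data.Bool.Base using (if_then_else_)
open import Data.Fin.Base using (Fin; zero; suc)
open import Data.Fin.Subset using (Subset; inside; outside; ∣_∣) renaming (_∈_ to _∈ₛ_; _∉_ to _∉ₛ_)
open import Data.Fin.Subset.Properties using (_∈?_; drop-there)
open import Data.List.Base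
  using (List; []; _∷_; _++_; map; length; iterate; tabulate; allFin; cartesianProduct; upTo)
open import Data.List.Membership.Propositional using (_∈_; find; lose)
open import Data.List.Membership.Propositional.Properties using (∈-allFin; ∈-cartesianProduct⁻; ∈-upTo⁻)
open import Data.List.Relation.Unary.All as All using ()
open import Data.List.Relation.Unary.AllPairs using ([]; _∷_)
open import Data.List.Relation.Unary.Any using (Any; here; there; any?)
open import Data.List.Relation.Unary.Unique.Propositional using (Unique)
open import Data.List.Relation.Unary.Unique.Propositional.Properties using (cartesianProduct⁺; allFin⁺)
open import Data.Nat.Base
open import Data.Nat.DivMod using (_/_; _%_; m≡m%n+[m/n]*n; m%n<n)
open import Data.Nat.Induction using (<-rec)
open import Data.Nat.Properties
open import Data.Nat.Tactic.RingSolver using (solve-∀)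
open import Data.Product.Base using (_×_; _,_; proj₁; proj₂; ∃-syntax)
open import Data.Sum.Base using (_⊎_; inj₁; inj₂)
open import Data.Unit.Base using (tt)
open import Data.Vec.Base using ([]; _∷_; here; there)
open import Function.Base using (_∘_; id)
open import Relation.Binary.Definitions using (Tri; tri<; tri≈; tri>)
open import Relation.Binary.PropositionalEquality
open import Relation.Nullary.Decidable using (Dec; yes; no; does; _×-dec_; _→-dec_; ¬?; toWitness)
open import Relation.Nullary.Negation using (¬_; contradiction)
open import Algebra.Properties.Semiring.Sum +-*-semiring using (sum-cong-≗)
open import Defs

-- Finite sums over lists

private variable
  A B : Set
  P Q : Set

Σₗ : List A → (A → ℕ) → ℕ
Σₗ []       f = 0
Σₗ (x ∷ xs) f = f x + Σₗ xs f

Σₗ-mono-∈ : ∀ (xs : List A) {f g : A → ℕ} → (∀ {x} → x ∈ xs → f x ≤ g x) → Σₗ xs f ≤ Σₗ xs g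
Σₗ-mono-∈ []       f≤g = z≤n
Σₗ-mono-∈ (x ∷ xs) f≤g = +-mono-≤ (f≤g (here refl)) (Σₗ-mono-∈ xs (f≤g ∘ there))

Σₗ-mono : ∀ (xs : List A) {f g : A → ℕ} → (∀ x → f x ≤ g x) → Σₗ xs f ≤ Σₗ xs g
Σₗ-mono xs f≤g = Σₗ-mono-∈ xs (λ {x} _ → f≤g x)

Σₗ-cong : ∀ (xs : List A) {f g : A → ℕ} → (∀ x → f x ≡ g x) → Σₗ xs f ≡ Σₗ xs g
Σₗ-cong []       f≡g = refl
Σₗ-cong (x ∷ xs) f≡g = cong₂ _+_ (f≡g x) (Σₗ-cong xs f≡g)

Σₗ-+ : ∀ (xs : List A) (f g : A → ℕ) → Σₗ xs (λ x → f x + g x) ≡ Σₗ xs f + Σₗ xs g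
Σₗ-+ []       f g = refl
Σₗ-+ (x ∷ xs) f g rewrite Σₗ-+ xs f g = shuffle (f x) (g x) (Σₗ xs f) (Σₗ xs g)
  where
  shuffle : ∀ a b c d → a + b + (c + d) ≡ a + c + (b + d)
  shuffle = solve-∀

Σₗ-* : ∀ (xs : List A) c (f : A → ℕ) → Σₗ xs (λ x → c * f x) ≡ c * Σₗ xs f
Σₗ-* []       c f = sym (*-zeroʳ c)
Σₗ-* (x ∷ xs) c f = trans (cong (c * f x +_) (Σₗ-* xs c f)) (sym (*-distribˡ-+ c (f x) _))

Σₗ-const : ∀ (xs : List A) c → Σₗ xs (λ _ → c) ≡ length xs * c
Σₗ-const []       c = refl
Σₗ-const (x ∷ xs) c = cong (c +_) (Σₗ-const xs c)

Σₗ-zero : ∀ (xs : List A) → Σₗ xs (λ _ → 0) ≡ 0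
Σₗ-zero xs = trans (Σₗ-const xs 0) (*-zeroʳ (length xs))

Σₗ-swap : ∀ (xs : List A) (ys : List B) (f : A → B → ℕ) →
          Σₗ xs (λ x → Σₗ ys (f x)) ≡ Σₗ ys (λ y → Σₗ xs (λ x → f x y))
Σₗ-swap []       ys f = sym (Σₗ-zero ys)
Σₗ-swap (x ∷ xs) ys f =
  trans (cong (Σₗ ys (f x) +_) (Σₗ-swap xs ys f)) (sym (Σₗ-+ ys (f x) _))

Σₗ-++ : ∀ (xs ys : List A) (f : A → ℕ) → Σₗ (xs ++ ys) f ≡ Σₗ xs f + Σₗ ys f
Σₗ-++ []       ys f = refl
Σₗ-++ (x ∷ xs) ys f = trans (cong (f x +_) (Σₗ-++ xs ys f)) (sym (+-assoc (f x) _ _))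

Σₗ-map : ∀ (xs : List A) (g : A → B) (f : B → ℕ) → Σₗ (map g xs) f ≡ Σₗ xs (f ∘ g)
Σₗ-map []       g f = refl
Σₗ-map (x ∷ xs) g f = cong (f (g x) +_) (Σₗ-map xs g f)

Σₗ-cartesianProduct : ∀ (xs : List A) (ys : List B) (f : A × B → ℕ) →
  Σₗ (cartesianProduct xs ys) f ≡ Σₗ xs (λ x → Σₗ ys (λ y → f (x , y)))
Σₗ-cartesianProduct []       ys f = refl
Σₗ-cartesianProduct (x ∷ xs) ys f =
  trans (Σₗ-++ (map (x ,_) ys) _ f)
        (cong₂ _+_ (Σₗ-map ys (x ,_) f) (Σₗ-cartesianProduct xs ys f))

∈⇒≤Σₗ : ∀ {xs : List A} {x} (f : A → ℕ) → x ∈ xs → f x ≤ Σₗ xs f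
∈⇒≤Σₗ f (here refl)                   = m≤m+n _ _
∈⇒≤Σₗ f (there {x = y} x∈xs) = ≤-trans (∈⇒≤Σₗ f x∈xs) (m≤n+m _ (f y))

Σₗ-strict : ∀ {xs : List A} {f g : A → ℕ} {x} → x ∈ xs →
            (∀ x → f x ≤ g x) → f x < g x → Σₗ xs f < Σₗ xs g
Σₗ-strict {xs = _ ∷ xs} (here refl)  f≤g f<g = +-mono-<-≤ f<g (Σₗ-mono xs f≤g)
Σₗ-strict {xs = _ ∷ _}  (there x∈xs) f≤g f<g = +-mono-≤-< (f≤g _) (Σₗ-strict x∈xs f≤g f<g)

Σₗ-positive : ∀ (xs : List A) (f : A → ℕ) → 0 < Σₗ xs f → ∃[ x ] x ∈ xs × 0 < f x
Σₗ-positive (x ∷ xs) f 0<Σ with f x in eq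
... | zero  = let y , y∈xs , 0<fy = Σₗ-positive xs f 0<Σ in y , there y∈xs , 0<fy
... | suc _ = x , here refl , subst (0 <_) (sym eq) (s≤s z≤n)

Σₗ-tabulate : ∀ n (g : Fin n → A) (f : A → ℕ) → Σₗ (tabulate g) f ≡ sum (f ∘ g)
Σₗ-tabulate zero    g f = refl
Σₗ-tabulate (suc n) g f = cong (f (g zero) +_) (Σₗ-tabulate n (g ∘ suc) f)

sum≡Σₗ : ∀ {n} (f : Fin n → ℕ) → sum f ≡ Σₗ (allFin n) f
sum≡Σₗ {n} f = sym (Σₗ-tabulate n id f)

-- Indicators of decidable propositions

opaque
  𝟙 : Dec P → ℕ
  𝟙 P? = if does P? then 1 else 0

  𝟙-yes : (P? : Dec P) → P → 𝟙 P? ≡ 1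
  𝟙-yes (yes _) p = refl
  𝟙-yes (no ¬p) p = contradiction p ¬p

  𝟙-no : (P? : Dec P) → ¬ P → 𝟙 P? ≡ 0
  𝟙-no (yes p) ¬p = contradiction p ¬p
  𝟙-no (no _)  ¬p = refl

  𝟙-≤ : ∀ {k} (P? : Dec P) → (P → 1 ≤ k) → 𝟙 P? ≤ k
  𝟙-≤ (yes p) f = f p
  𝟙-≤ (no _)  f = z≤n

  𝟙-positive : (P? : Dec P) → 0 < 𝟙 P? → P
  𝟙-positive (yes p) _ = p

  𝟙*-≤ : ∀ {m n} (P? : Dec P) → (P → m ≤ n) → 𝟙 P? * m ≤ n
  𝟙*-≤ (yes p) f = ≤-trans (≤-reflexive (+-identityʳ _)) (f p)
  𝟙*-≤ (no _)  f = z≤n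

  𝟙*-positive : ∀ {m} (P? : Dec P) → 0 < 𝟙 P? * m → P × 0 < m
  𝟙*-positive (yes p) 0<m = p , subst (0 <_) (+-identityʳ _) 0<m

  if≡𝟙* : (P? : Dec P) (m : ℕ) → (if does P? then m else 0) ≡ 𝟙 P? * m
  if≡𝟙* (yes _) m = sym (+-identityʳ m)
  if≡𝟙* (no _)  m = refl

𝟙-mono : (P? : Dec P) (Q? : Dec Q) → (P → Q) → 𝟙 P? ≤ 𝟙 Q?
𝟙-mono P? Q? f = 𝟙-≤ P? (λ p → ≤-reflexive (sym (𝟙-yes Q? (f p))))

≤-𝟙* : ∀ (P? : Dec P) m → P → m ≤ 𝟙 P? * m
≤-𝟙* P? m p rewrite 𝟙-yes P? p = ≤-reflexive (sym (+-identityʳ m))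

Σₗ-single : ∀ {xs : List A} {f : A → ℕ} {c} → Unique xs →
            (∀ {x y} → 0 < f x → 0 < f y → x ≡ y) → (∀ x → f x ≤ c) → Σₗ xs f ≤ c
Σₗ-single {xs = []} [] same f≤c = z≤n
Σₗ-single {xs = x ∷ xs} {f} {c} (x∉xs ∷ u) same f≤c with f x in eq
... | zero  = Σₗ-single u same f≤c
... | suc k = begin
  suc k + Σₗ xs f ≤⟨ +-monoʳ-≤ (suc k) rest ⟩
  suc k + 0       ≡⟨ +-identityʳ _ ⟩
  suc k           ≡⟨ eq ⟨
  f x             ≤⟨ f≤c x ⟩
  c               ∎
  where
  open ≤-Reasoning
  rest : Σₗ xs f ≤ 0
  rest = ≮⇒≥ λ 0<Σ → let y , y∈xs , 0<fy = Σₗ-positive xs f 0<Σ in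
    All.lookup x∉xs y∈xs (same (subst (0 <_) (sym eq) (s≤s z≤n)) 0<fy)

-- Intervals of natural numbers and sums over them

range : ℕ → ℕ → List ℕ
range = iterate suc

∈-range⁺ : ∀ {l k t} → l ≤ t → t < l + k → t ∈ range l k
∈-range⁺ {l} {zero}  l≤t t<l+0 = contradiction (subst (_ <_) (+-identityʳ l) t<l+0) (≤⇒≯ l≤t)
∈-range⁺ {l} {suc k} {t} l≤t t<l+k with l ≟ t
... | yes refl = here refl
... | no l≢t   = there (∈-range⁺ (≤∧≢⇒< l≤t l≢t) (subst (t <_) (+-suc l k) t<l+k))

∈-range⁻ : ∀ {l} k {t} → t ∈ range l k → l ≤ t × t < l + k
∈-range⁻ {l} (suc k) (here refl) = ≤-refl , m<m+n l (s≤s z≤n)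
∈-range⁻ {l} (suc k) {t} (there t∈) =
  let l<t , t< = ∈-range⁻ k t∈ in <⇒≤ l<t , subst (t <_) (sym (+-suc l k)) t<

length-range : ∀ l k → length (range l k) ≡ k
length-range l zero    = refl
length-range l (suc k) = cong suc (length-range (suc l) k)

range-unique : ∀ l k → Unique (range l k)
range-unique l zero    = []
range-unique l (suc k) =
  All.tabulate (λ t∈ l≡t → <⇒≢ (proj₁ (∈-range⁻ k t∈)) l≡t) ∷ range-unique (suc l) k

Σₗ-range-+ : ∀ l j k f → Σₗ (range l (j + k)) f ≡ Σₗ (range l j) f + Σₗ (range (l + j) k) f
Σₗ-range-+ l zero    k f rewrite +-identityʳ l = refl
Σₗ-range-+ l (suc j) k f rewrite Σₗ-range-+ (suc l) j k f | +-suc l j =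
  sym (+-assoc (f l) _ _)

Σₗ-range-≥ : ∀ {c f} l k → (∀ {t} → l ≤ t → t < l + k → c ≤ f t) → k * c ≤ Σₗ (range l k) f
Σₗ-range-≥ {c} {f} l k c≤f = begin
  k * c                      ≡⟨ cong (_* c) (length-range l k) ⟨
  length (range l k) * c     ≡⟨ Σₗ-const (range l k) c ⟨
  Σₗ (range l k) (λ _ → c)
    ≤⟨ Σₗ-mono-∈ (range l k) (λ t∈ → let l≤t , t< = ∈-range⁻ k t∈ in c≤f l≤t t<) ⟩
  Σₗ (range l k) f           ∎
  where open ≤-Reasoning

Σₗ-charge : ∀ (xs : List A) (ys : List B) {f : A → ℕ} (g : A → B → ℕ) (c : B → ℕ) →
  (∀ {x} → x ∈ xs → f x ≤ Σₗ ys (g x)) → (∀ y → Σₗ xs (λ x → g x y) ≤ c y) → Σₗ xs f ≤ Σₗ ys c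
Σₗ-charge xs ys {f} g c f≤ ≤c = begin
  Σₗ xs f                              ≤⟨ Σₗ-mono-∈ xs f≤ ⟩
  Σₗ xs (λ x → Σₗ ys (g x))            ≡⟨ Σₗ-swap xs ys g ⟩
  Σₗ ys (λ y → Σₗ xs (λ x → g x y))    ≤⟨ Σₗ-mono ys ≤c ⟩
  Σₗ ys c                              ∎
  where open ≤-Reasoning

-- If m > 0 values are counted, they are l + 1, ..., l + m, so c(l + m) < Y. The start `l` is
-- arbitrary for the sake of the induction on `k`.
count-initial : ∀ c Y l k → c * Σₗ (range (suc l) k) (λ ρ → 𝟙 (c * ρ <? Y)) ≤ Y ∸ c * l
count-initial c Y l zero    = subst (_≤ Y ∸ c * l) (sym (*-zeroʳ c)) z≤n
count-initial c Y l (suc k) = step (c * suc l <? Y) (count-initial c Y (suc l) k)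
  where
  open ≤-Reasoning
  step : ∀ {S} (d : Dec (c * suc l < Y)) → c * S ≤ Y ∸ c * suc l → c * (𝟙 d + S) ≤ Y ∸ c * l
  step d@(no ≮Y) ih rewrite 𝟙-no d ≮Y = ≤-trans ih (∸-monoʳ-≤ Y (*-monoʳ-≤ c (n≤1+n l)))
  step {S} d@(yes <Y) ih rewrite 𝟙-yes d <Y = begin
    c * (1 + S)              ≡⟨ *-suc c S ⟩
    c + c * S                ≤⟨ +-monoʳ-≤ c ih ⟩
    c + (Y ∸ c * suc l)      ≡⟨ +-∸-assoc c (<⇒≤ <Y) ⟨
    c + Y ∸ c * suc l        ≡⟨ cong (c + Y ∸_) (*-suc c l) ⟩
    c + Y ∸ (c + c * l)      ≡⟨ [m+n]∸[m+o]≡n∸o c Y (c * l) ⟩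
    Y ∸ c * l                ∎

count-≤ : ∀ c l k → Σₗ (range (suc l) k) (λ y → 𝟙 (y ≤? c)) ≤ c ∸ l
count-≤ c l zero    = z≤n
count-≤ c l (suc k) = step (suc l ≤? c) (count-≤ c (suc l) k)
  where
  step : ∀ {S} (d : Dec (suc l ≤ c)) → S ≤ c ∸ suc l → 𝟙 d + S ≤ c ∸ l
  step d@(no l≮c)  ih rewrite 𝟙-no d l≮c  = ≤-trans ih (∸-monoʳ-≤ c (n≤1+n l))
  step d@(yes l<c) ih rewrite 𝟙-yes d l<c = ≤-trans (s≤s ih) (≤-reflexive (sym (+-∸-assoc 1 l<c)))

count-≥ : ∀ c k → c ≤ k → c ≤ Σₗ (range 1 k) (λ y → 𝟙 (y ≤? c))
count-≥ c k c≤k = begin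
  c                                                  ≡⟨ *-identityʳ c ⟨
  c * 1
    ≤⟨ Σₗ-range-≥ 1 c (λ { {t} _ (s≤s t≤c) → ≤-reflexive (sym (𝟙-yes (t ≤? c) t≤c)) }) ⟩
  Σₗ (range 1 c) (λ y → 𝟙 (y ≤? c))                  ≤⟨ m≤m+n _ _ ⟩
  Σₗ (range 1 c) _ + Σₗ (range (1 + c) (k ∸ c)) _    ≡⟨ Σₗ-range-+ 1 c (k ∸ c) _ ⟨
  Σₗ (range 1 (c + (k ∸ c))) (λ y → 𝟙 (y ≤? c))
    ≡⟨ cong (λ j → Σₗ (range 1 j) (λ y → 𝟙 (y ≤? c))) (m+[n∸m]≡n c≤k) ⟩
  Σₗ (range 1 k) (λ y → 𝟙 (y ≤? c))                  ∎
  where open ≤-Reasoning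

-- Arithmetic of the thresholds

-- Multiplied out, the middle inequality reads i² ≤ 4i. It holds for i ≤ 4 and fails at i = 5, which
-- ties the five factors to the fraction 1/52.
threshold-arithmetic : ∀ {i} → i < 5 →
  (100 + i) + (100 ∸ i) ≡ 200 × (100 ∸ i) * 52 ≤ (52 ∸ i) * (100 + i) × 0 < 52 ∸ i
threshold-arithmetic = toWitness
  {a? = allUpTo? (λ i → ((100 + i) + (100 ∸ i) ≟ 200) ×-dec
                        ((100 ∸ i) * 52 ≤? (52 ∸ i) * (100 + i)) ×-dec (0 <? 52 ∸ i)) 5} tt

-- Inserting `y ≤ (100 ∸ i) * X` and cancelling `X` leaves (100 + i)ρ < (100 - i)β, and (100 -
-- i)/(100 + i) ≤ (52 - i)/52.
below-threshold : ∀ {i X y ρ β} → i < 5 → 200 * X * ρ < y * (ρ + β) → y ≤ (100 ∸ i) * X →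
                  52 * ρ < (52 ∸ i) * β
below-threshold {i} {X} {y} {ρ} {β} i<5 low y≤ = *-cancelˡ-< c (52 * ρ) (c′ * β) (begin-strict
  c * (52 * ρ)  ≡⟨ *-assoc c 52 ρ ⟨
  c * 52 * ρ    ≤⟨ *-monoˡ-≤ ρ (proj₁ (proj₂ arith)) ⟩
  c′ * d * ρ    ≡⟨ *-assoc c′ d ρ ⟩
  c′ * (d * ρ)  <⟨ *-monoʳ-< c′ {{>-nonZero (proj₂ (proj₂ arith))}} dρ<cβ ⟩
  c′ * (c * β)  ≡⟨ exchange c′ c β ⟩
  c * (c′ * β)  ∎)
  where
  open ≤-Reasoning
  c d c′ : ℕ
  c  = 100 ∸ i
  d  = 100 + i
  c′ = 52 ∸ i
  arith = threshold-arithmetic i<5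
  exchange : ∀ a b e → a * (b * e) ≡ b * (a * e)
  exchange = solve-∀
  expand : ∀ c d X ρ → X * (d * ρ + c * ρ) ≡ (d + c) * X * ρ
  expand = solve-∀
  regroup : ∀ c X ρ β → c * X * (ρ + β) ≡ X * (c * β + c * ρ)
  regroup = solve-∀
  dρ<cβ : d * ρ < c * β
  dρ<cβ = +-cancelʳ-< (c * ρ) (d * ρ) (c * β) (*-cancelˡ-< X _ _ (begin-strict
    X * (d * ρ + c * ρ) ≡⟨ expand c d X ρ ⟩
    (d + c) * X * ρ     ≡⟨ cong (λ z → z * X * ρ) (proj₁ arith) ⟩
    200 * X * ρ         <⟨ low ⟩
    y * (ρ + β)         ≤⟨ *-monoˡ-≤ (ρ + β) y≤ ⟩
    c * X * (ρ + β)     ≡⟨ regroup c X ρ β ⟩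
    X * (c * β + c * ρ) ∎))

-- Bounds how many of the five thresholds a broadcast can meet if its `o` lies `ρ` before the start
-- of a run and it takes place `β` after the low time preceding that run.
levels : ℕ → ℕ → ℕ
levels ρ β = Σₗ (upTo 5) (λ i → 𝟙 (52 * ρ <? (52 ∸ i) * β))

-- The five intervals [(52 ∸ i) Z / 52 , (52 ∸ i) (Z + h) / 52) are disjoint.
levels-shift : ∀ ρ {β} Z h → 52 * h ≤ Z + h → β ≤ Z + h → levels ρ β ≤ 𝟙 (Z <? β) + levels ρ Z
levels-shift ρ {β} Z h 52h≤ β≤ = by-cases (Z <? β)
  where
  open ≤-Reasoning
  drop : ∀ i → (52 ∸ suc i) * β ≤ (52 ∸ i) * Z
  drop i with 52 ∸ i in eq | 52 ∸ suc i in eq′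
  ... | zero  | zero  = z≤n
  ... | zero  | suc c = contradiction
    (subst₂ _≤_ eq′ eq (∸-monoʳ-≤ 52 (n≤1+n i))) λ ()
  -- Here c + 1 = 52 - i is at most 52, so (c + 1)h ≤ Z + h and hence c(Z + h) ≤ (c + 1)Z.
  ... | suc c | c′ = +-cancelˡ-≤ (Z + h) _ _ (begin
    Z + h + c′ * β        ≤⟨ +-monoʳ-≤ (Z + h) (*-mono-≤ c′≤c β≤) ⟩
    suc c * (Z + h)       ≡⟨ *-distribˡ-+ (suc c) Z h ⟩
    suc c * Z + suc c * h ≤⟨ +-monoʳ-≤ (suc c * Z) (≤-trans (*-monoˡ-≤ h c<52) 52h≤) ⟩
    suc c * Z + (Z + h)   ≡⟨ +-comm (suc c * Z) (Z + h) ⟩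
    Z + h + suc c * Z     ∎)
    where
    c<52 : suc c ≤ 52
    c<52 = subst (_≤ 52) eq (m∸n≤m 52 i)
    c′≤c : c′ ≤ c
    c′≤c = ≤-reflexive (trans (sym eq′) (trans (sym (pred[m∸n]≡m∸[1+n] 52 i)) (cong pred eq)))
  next : ∀ i → 𝟙 (52 * ρ <? (52 ∸ suc i) * β) ≤ 𝟙 (52 * ρ <? (52 ∸ i) * Z)
  next i = 𝟙-mono (52 * ρ <? (52 ∸ suc i) * β) (52 * ρ <? (52 ∸ i) * Z) (λ lt → <-≤-trans lt (drop i))
  by-cases : (d : Dec (Z < β)) → levels ρ β ≤ 𝟙 d + levels ρ Z
  by-cases d@(no Z≮β) = ≤-trans
    (Σₗ-mono (upTo 5) (λ i → 𝟙-mono (52 * ρ <? (52 ∸ i) * β) (52 * ρ <? (52 ∸ i) * Z)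
      (λ lt → <-≤-trans lt (*-monoʳ-≤ (52 ∸ i) (≮⇒≥ Z≮β)))))
    (m≤n+m (levels ρ Z) (𝟙 d))
  by-cases d@(yes Z<β) rewrite 𝟙-yes d Z<β =
    -- Threshold 0 at `β` is paid by the indicator, threshold i + 1 at `β` by threshold i at `Z`;
    -- threshold 4 at `Z` is left over.
    +-mono-≤ (𝟙-≤ (52 * ρ <? 52 * β) (λ _ → ≤-refl))
      (+-mono-≤ (next 0) (+-mono-≤ (next 1) (+-mono-≤ (next 2) (+-mono-≤ (next 3) z≤n))))

Σ-levels : ∀ Z k → 52 * Σₗ (range 1 k) (λ ρ → levels ρ Z) ≤ 250 * Z
Σ-levels Z k = begin
  52 * Σₗ (range 1 k) (λ ρ → levels ρ Z)
    ≡⟨ cong (52 *_) (Σₗ-swap (range 1 k) (upTo 5) (λ ρ i → 𝟙 (52 * ρ <? (52 ∸ i) * Z))) ⟩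
  52 * Σₗ (upTo 5) (λ i → Σₗ (range 1 k) (λ ρ → 𝟙 (52 * ρ <? (52 ∸ i) * Z)))
    ≡⟨ Σₗ-* (upTo 5) 52 (λ i → Σₗ (range 1 k) (λ ρ → 𝟙 (52 * ρ <? (52 ∸ i) * Z))) ⟨
  Σₗ (upTo 5) (λ i → 52 * Σₗ (range 1 k) (λ ρ → 𝟙 (52 * ρ <? (52 ∸ i) * Z)))
    ≤⟨ Σₗ-mono (upTo 5) (λ i → count-initial 52 ((52 ∸ i) * Z) 0 k) ⟩
  Σₗ (upTo 5) (λ i → (52 ∸ i) * Z)
    ≡⟨ collect Z ⟩
  250 * Z ∎
  where
  open ≤-Reasoning
  collect : ∀ Z → 52 * Z + (51 * Z + (50 * Z + (49 * Z + (48 * Z + 0)))) ≡ 250 * Z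
  collect = solve-∀

-- Comparison up to a constant factor

opaque
  infix 4 _≼_

  -- The factor 45687/5408, about 8.448, bounds the weight per heavy broadcast. It has to stay below
  -- 1690/200 = 8.45: the weight per unit of `X` is 1690, and a unit of waiting time makes 200
  -- levels.
  _≼_ : ℕ → ℕ → Set
  m ≼ n = 5408 * m ≤ 45687 * n

  ≼⇒≤ : ∀ {m n} → m ≼ n → 5408 * m ≤ 45687 * n
  ≼⇒≤ p = p

  ≤⇒≼ : ∀ {m n} → 5408 * m ≤ 45687 * n → m ≼ n
  ≤⇒≼ p = p

  0≼ : ∀ {m} n → m ≤ 0 → m ≼ n
  0≼ n m≤0 = ≤-trans (*-monoʳ-≤ 5408 m≤0) z≤n

  ≼-resp-≤ : ∀ {m m′ n n′} → m ≤ m′ → n′ ≤ n → m′ ≼ n′ → m ≼ n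
  ≼-resp-≤ m≤m′ n′≤n p = ≤-trans (*-monoʳ-≤ 5408 m≤m′) (≤-trans p (*-monoʳ-≤ 45687 n′≤n))

  ≼-+ : ∀ {m m′ n n′} → m ≼ n → m′ ≼ n′ → m + m′ ≼ n + n′
  ≼-+ {m} {m′} {n} {n′} p q = begin
    5408 * (m + m′)       ≡⟨ *-distribˡ-+ 5408 m m′ ⟩
    5408 * m + 5408 * m′  ≤⟨ +-mono-≤ p q ⟩
    45687 * n + 45687 * n′ ≡⟨ *-distribˡ-+ 45687 n n′ ⟨
    45687 * (n + n′)      ∎
    where open ≤-Reasoning

≼-Σₗ : ∀ {A : Set} (xs : List A) {f g : A → ℕ} → (∀ {x} → x ∈ xs → f x ≼ g x) → Σₗ xs f ≼ Σₗ xs g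
≼-Σₗ []       f≼g = 0≼ 0 z≤n
≼-Σₗ (x ∷ xs) f≼g = ≼-+ (f≼g (here refl)) (≼-Σₗ xs (f≼g ∘ there))

-- A linear combination of the hypotheses, in which 104 · 52 = 5408, 84 · 52 = 104 · (250 - 208) and
-- 32448 + 13239 = 45687.
combine : ∀ {M P A R Z h} → Z + h ≡ suc R → R ≤ 52 * h + 50 →
          4 * R ≤ A → 2 * M + 1 ≤ A → 52 * P ≤ 260 * R + 208 * h + 250 * Z →
          12 * M + P ≼ A
combine {M} {P} {A} {R} {Z} {h} Z+h≡1+R R≤ 4R≤A 2M+1≤A 52P≤ =
  ≤⇒≼ (+-cancelʳ-≤ (32448 * 1 + 4368 * h + 84 * R) (5408 * (12 * M + P)) (45687 * A) (begin
    5408 * (12 * M + P) + (32448 * 1 + 4368 * h + 84 * R)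
      ≡⟨ e₁ M P h R 1 ⟩
    32448 * (2 * M + 1) + 104 * (52 * P) + (4368 * h + 84 * R)
      ≤⟨ +-mono-≤ (+-mono-≤ (*-monoʳ-≤ 32448 2M+1≤A) (*-monoʳ-≤ 104 52P≤)) (+-monoʳ-≤ (4368 * h) (*-monoʳ-≤ 84 R≤)) ⟩
    32448 * A + 104 * (260 * R + 208 * h + 250 * Z) + (4368 * h + 84 * (52 * h + 50 * 1))
      ≡⟨ e₂ A R h Z 1 ⟩
    32448 * A + 27040 * R + 4368 * h + 26000 * (Z + h) + 4200 * 1
      ≡⟨ cong (λ z → 32448 * A + 27040 * R + 4368 * h + 26000 * z + 4200 * 1) Z+h≡1+R ⟩
    32448 * A + 27040 * R + 4368 * h + 26000 * (1 + R) + 4200 * 1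
      ≡⟨ e₃ A R h 1 ⟩
    32448 * A + 13239 * (4 * R) + (30200 * 1 + 4368 * h + 84 * R)
      ≤⟨ +-mono-≤ (+-monoʳ-≤ (32448 * A) (*-monoʳ-≤ 13239 4R≤A))
                  -- Rounding costs 30200. The 1 in `2 * M + 1 ≤ A` pays 2704 per unit of extra
                  -- weight, so 12 is the least integer weight that suffices here.
                  (+-monoˡ-≤ (84 * R) (+-monoˡ-≤ (4368 * h) (*-monoˡ-≤ 1 (≤ᵇ⇒≤ 30200 32448 tt)))) ⟩
    32448 * A + 13239 * A + (32448 * 1 + 4368 * h + 84 * R)
      ≡⟨ e₄ A h R 1 ⟩
    45687 * A + (32448 * 1 + 4368 * h + 84 * R) ∎))
  where
  open ≤-Reasoning
  -- The unit u stands for 1: it keeps the solver from unfolding large numerals.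
  e₁ : ∀ M P h R u → 5408 * (12 * M + P) + (32448 * u + 4368 * h + 84 * R)
                   ≡ 32448 * (2 * M + u) + 104 * (52 * P) + (4368 * h + 84 * R)
  e₁ = solve-∀
  e₂ : ∀ A R h Z u → 32448 * A + 104 * (260 * R + 208 * h + 250 * Z) + (4368 * h + 84 * (52 * h + 50 * u))
                   ≡ 32448 * A + 27040 * R + 4368 * h + 26000 * (Z + h) + 4200 * u
  e₂ = solve-∀
  e₃ : ∀ A R h u → 32448 * A + 27040 * R + 4368 * h + 26000 * (u + R) + 4200 * u
                 ≡ 32448 * A + 13239 * (4 * R) + (30200 * u + 4368 * h + 84 * R)
  e₃ = solve-∀
  e₄ : ∀ A h R u → 32448 * A + 13239 * A + (32448 * u + 4368 * h + 84 * R)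
                 ≡ 45687 * A + (32448 * u + 4368 * h + 84 * R)
  e₄ = solve-∀

-- `h` is the integer part of (R + 1)/52, and the remainder is at most 51.
fifty-second : ∀ R → ∃[ Z ] ∃[ h ] Z + h ≡ suc R × 52 * h ≤ Z + h × R ≤ 52 * h + 50
fifty-second R = suc R ∸ h , h , Z+h≡ , subst (52 * h ≤_) (sym Z+h≡) 52h≤ , s≤s⁻¹ (begin
  suc R                ≡⟨ div ⟩
  suc R % 52 + h * 52  ≤⟨ +-monoˡ-≤ (h * 52) (s≤s⁻¹ (m%n<n (suc R) 52)) ⟩
  51 + h * 52          ≡⟨ rearrange h ⟩
  suc (52 * h + 50)    ∎)
  where
  open ≤-Reasoning
  h : ℕ
  h = suc R / 52
  div : suc R ≡ suc R % 52 + h * 52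
  div = m≡m%n+[m/n]*n (suc R) 52
  52h≤ : 52 * h ≤ suc R
  52h≤ = subst (52 * h ≤_) (sym div) (≤-trans (≤-reflexive (*-comm 52 h)) (m≤n+m (h * 52) _))
  Z+h≡ : suc R ∸ h + h ≡ suc R
  Z+h≡ = m∸n+n≡m (≤-trans (m≤n*m h 52) 52h≤)
  rearrange : ∀ h → 51 + h * 52 ≡ suc (52 * h + 50)
  rearrange = solve-∀

-- The charging argument for an abstract family of ramps

module Charging {E : Set} (es : List E) (o b X : E → ℕ)
  -- In the application an `e` with `0 < X e` is a broadcast of LWF at `b e`, `o e` is the preceding
  -- broadcast of its page by the other schedule, and `X e` is the overtaken waiting time. `o-once`
  -- reflects speed 1, `b-cap` speed 4.
  (0<o    : ∀ {e} → 0 < X e → 0 < o e)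
  (o<b    : ∀ {e} → 0 < X e → o e < b e)
  (o-once : ∀ u → Σₗ es (λ e → 𝟙 ((0 <? X e) ×-dec (o e ≟ u))) ≤ 1)
  (b-cap  : ∀ t → Σₗ es (λ e → 𝟙 ((0 <? X e) ×-dec (b e ≟ t))) ≤ 4) where

  lev : ℕ → E → ℕ
  lev y e = Σₗ (upTo 5) (λ i → 𝟙 (y ≤? (100 ∸ i) * X e))

  -- Threshold i belongs to the factor 200/(100 - i). The factor 2 counts 13 times in all: once in
  -- `lev` and 12 times extra.
  weight : ℕ → E → ℕ
  weight y e = 12 * 𝟙 (y ≤? 100 * X e) + lev y e

  -- The ramp X(t + 1 - o)/(b + 1 - o), in units of 1/200, is at least `y` at `t`; the denominator
  -- is cleared.
  Covers : ℕ → ℕ → E → Set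
  Covers y t e = o e ≤ t × t < b e × y * (suc (b e) ∸ o e) ≤ 200 * X e * (suc t ∸ o e)

  covers? : ∀ y t e → Dec (Covers y t e)
  covers? y t e = (o e ≤? t) ×-dec (t <? b e) ×-dec (y * (suc (b e) ∸ o e) ≤? 200 * X e * (suc t ∸ o e))

  module Level (y : ℕ) (0<y : 0 < y) (a : ℕ → ℕ)
    -- `a t` stands for the number of broadcasts at `t` with waiting time at least `y`/200.
    (busy : ∀ {e t} → e ∈ es → Covers y t e → 4 ≤ a t)
    (own  : ∀ {e} → e ∈ es → y ≤ 100 * X e → 1 ≤ a (b e)) where

    High : ℕ → Set
    High t = Any (Covers y t) es

    high? : ∀ t → Dec (High t)
    high? t = any? (covers? y t) es

    high⇒4≤a : ∀ {t} → High t → 4 ≤ a t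
    high⇒4≤a h = let e , e∈es , c = find h in busy e∈es c

    positive : ∀ {e} c → y ≤ c * X e → 0 < X e
    positive {e} c y≤ with X e
    ... | zero  = contradiction (<-≤-trans 0<y y≤) (subst (λ z → ¬ 0 < z) (sym (*-zeroʳ c)) λ ())
    ... | suc _ = s≤s z≤n

    threshold≤ : ∀ i {e} → y ≤ (100 ∸ i) * X e → y ≤ 100 * X e
    threshold≤ i {e} y≤ = ≤-trans y≤ (*-monoˡ-≤ (X e) (m∸n≤m 100 i))

    lev≤5 : ∀ e → lev y e ≤ 5
    lev≤5 e = Σₗ-mono (upTo 5) {g = λ _ → 1} (λ i → 𝟙-≤ (y ≤? (100 ∸ i) * X e) (λ _ → ≤-refl))

    lev≡0 : ∀ e → ¬ y ≤ 100 * X e → lev y e ≡ 0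
    lev≡0 e ≰ = n≤0⇒n≡0 (Σₗ-mono (upTo 5) {g = λ _ → 0} (λ i →
      ≤-reflexive (𝟙-no (y ≤? (100 ∸ i) * X e) (λ y≤ → ≰ (threshold≤ i y≤)))))

    weight≡0 : ∀ e → ¬ y ≤ 100 * X e → weight y e ≡ 0
    weight≡0 e ≰ = cong₂ (λ m n → 12 * m + n) (𝟙-no (y ≤? 100 * X e) ≰) (lev≡0 e ≰)

    -- With j = b - o ≥ 1 the ramp has the value Xj/(j + 1) ≥ X/2 at b - 1. So every broadcast with
    -- positive weight directly follows a high time.
    covers-last : ∀ {e k} → y ≤ 100 * X e → b e ≡ suc k → Covers y k e
    covers-last {e} {k} y≤ be≡ = o≤k , ≤-reflexive (sym be≡) , (begin
      y * (suc (b e) ∸ o e)          ≡⟨ cong (λ z → y * (suc z ∸ o e)) be≡ ⟩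
      y * (suc (suc k) ∸ o e)        ≡⟨ cong (y *_) (+-∸-assoc 1 (m≤n⇒m≤1+n o≤k)) ⟩
      y * suc j                      ≤⟨ *-mono-≤ y≤ (+-monoˡ-≤ j 1≤j) ⟩
      100 * X e * (j + j)            ≡⟨ double (X e) j ⟩
      200 * X e * j                  ∎)
      where
      open ≤-Reasoning
      double : ∀ x j → 100 * x * (j + j) ≡ 200 * x * j
      double = solve-∀
      j : ℕ
      j = suc k ∸ o e
      o≤k : o e ≤ k
      o≤k = s≤s⁻¹ (subst (o e <_) be≡ (o<b (positive 100 y≤)))
      1≤j : 1 ≤ j
      1≤j = m<n⇒0<n∸m (s≤s o≤k)

    module Run (k R : ℕ) (0<R : 0 < R) (low : ¬ High k)
               (high : ∀ {t} → k < t → t ≤ k + R → High t) where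

      -- It is b - 1 that lies in the run, in accordance with `covers-last`; the slots likewise
      -- extend one time past the run.
      InRun : E → Set
      InRun e = suc k < b e × b e ≤ suc (k + R)

      inRun? : ∀ e → Dec (InRun e)
      inRun? e = (suc k <? b e) ×-dec (b e ≤? suc (k + R))

      Counted : E → Set
      Counted e = InRun e × y ≤ 100 * X e

      counted? : ∀ e → Dec (Counted e)
      counted? e = inRun? e ×-dec (y ≤? 100 * X e)

      #counted Σlev #slots : ℕ
      #counted = Σₗ es (λ e → 𝟙 (counted? e))
      Σlev = Σₗ es (λ e → 𝟙 (inRun? e) * lev y e)
      #slots = Σₗ (range (suc k) (suc R)) a

      -- Time `k` is low, so the ramp is still below `y` there and cannot have started long before.
      reach : ∀ {e} → e ∈ es → InRun e → o e ≤ k → ∀ {i} → i < 5 → y ≤ (100 ∸ i) * X e →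
              52 * (suc k ∸ o e) < (52 ∸ i) * (b e ∸ k)
      reach {e} e∈es (1+k<b , _) o≤k i<5 y≤ =
        below-threshold {X = X e} {y = y} {ρ = suc k ∸ o e} {β = b e ∸ k} i<5
          (subst (λ z → 200 * X e * (suc k ∸ o e) < y * z) split (≰⇒> λ c → low (lose e∈es (o≤k , k<b , c))))
          y≤
        where
        k<b : k < b e
        k<b = <-trans (n<1+n k) 1+k<b
        split : suc (b e) ∸ o e ≡ (suc k ∸ o e) + (b e ∸ k)
        split = trans (cong (λ z → suc z ∸ o e) (sym (m+[n∸m]≡n (<⇒≤ k<b))))
                      (+-∸-comm (b e ∸ k) (m≤n⇒m≤1+n o≤k))

      -- The counted `o` are distinct and lie between k - m + 1 and k + m: on the left by `reach`
      -- with i = 0, on the right because o < b. They are shifted by `m` to avoid truncated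
      -- subtraction.
      count-bound : ∀ m → (∀ {e} → e ∈ es → Counted e → b e ≤ k + suc m) → #counted ≤ 2 * m
      count-bound m b≤ = begin
        #counted
          ≤⟨ Σₗ-charge es (range (suc k) (2 * m)) (λ e u → 𝟙 (shifted? e u)) (λ _ → 1) hits once ⟩
        Σₗ (range (suc k) (2 * m)) (λ _ → 1)  ≡⟨ Σₗ-const (range (suc k) (2 * m)) 1 ⟩
        length (range (suc k) (2 * m)) * 1    ≡⟨ *-identityʳ _ ⟩
        length (range (suc k) (2 * m))        ≡⟨ length-range (suc k) (2 * m) ⟩
        2 * m                           ∎
        where
        open ≤-Reasoning
        shifted? : ∀ e u → Dec (0 < X e × o e + m ≡ u)
        shifted? e u = (0 <? X e) ×-dec (o e + m ≟ u)
        once : ∀ u → Σₗ es (λ e → 𝟙 (shifted? e u)) ≤ 1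
        once u = ≤-trans
          (Σₗ-mono es (λ e → 𝟙-mono (shifted? e u) ((0 <? X e) ×-dec (o e ≟ u ∸ m))
            (λ (0<X , eq) → 0<X , trans (sym (m+n∸n≡m (o e) m)) (cong (_∸ m) eq))))
          (o-once (u ∸ m))
        left : ∀ {e} → e ∈ es → Counted e → suc k ≤ o e + m
        left {e} e∈es c@(inRun , y≤) with o e ≤? k
        ... | no o≰k  = ≤-trans (≰⇒> o≰k) (m≤m+n (o e) m)
        ... | yes o≤k = begin
          suc k               ≡⟨ m+[n∸m]≡n (m≤n⇒m≤1+n o≤k) ⟨
          o e + (suc k ∸ o e) ≤⟨ +-monoʳ-≤ (o e) (s≤s⁻¹ (<-≤-trans
             (*-cancelˡ-< 52 _ _ (reach e∈es inRun o≤k {0} (s≤s z≤n) y≤))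
             (m≤n+o⇒m∸n≤o (b e) k (b≤ e∈es c)))) ⟩
          o e + m             ∎
        right : ∀ {e} → e ∈ es → Counted e → o e + m < suc k + 2 * m
        right {e} e∈es c@(_ , y≤) = s≤s (begin
          o e + m
            ≤⟨ +-monoˡ-≤ m (s≤s⁻¹ (<-≤-trans (o<b (positive 100 y≤)) (subst (b e ≤_) (+-suc k m) (b≤ e∈es c)))) ⟩
          k + m + m   ≡⟨ twice k m ⟩
          k + 2 * m   ∎)
          where
          twice : ∀ k m → k + m + m ≡ k + 2 * m
          twice = solve-∀
        hits : ∀ {e} → e ∈ es → 𝟙 (counted? e) ≤ Σₗ (range (suc k) (2 * m)) (λ u → 𝟙 (shifted? e u))
        hits {e} e∈es = 𝟙-≤ (counted? e) λ c → begin
          1                          ≡⟨ 𝟙-yes (shifted? e (o e + m)) (positive 100 (proj₂ c) , refl) ⟨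
          𝟙 (shifted? e (o e + m))
            ≤⟨ ∈⇒≤Σₗ (λ u → 𝟙 (shifted? e u)) (∈-range⁺ (left e∈es c) (right e∈es c)) ⟩
          Σₗ (range (suc k) (2 * m)) (λ u → 𝟙 (shifted? e u)) ∎

      #slots-split : #slots ≡ Σₗ (range (suc k) R) a + a (suc k + R)
      #slots-split = begin
        #slots
          ≡⟨ cong (λ z → Σₗ (range (suc k) z) a) (+-comm 1 R) ⟩
        Σₗ (range (suc k) (R + 1)) a                            ≡⟨ Σₗ-range-+ (suc k) R 1 a ⟩
        Σₗ (range (suc k) R) a + (a (suc k + R) + 0)
          ≡⟨ cong (Σₗ (range (suc k) R) a +_) (+-identityʳ _) ⟩
        Σₗ (range (suc k) R) a + a (suc k + R)                  ∎
        where open ≡-Reasoning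

      4R≤Σ : 4 * R ≤ Σₗ (range (suc k) R) a
      4R≤Σ = ≤-trans (≤-reflexive (*-comm 4 R))
        (Σₗ-range-≥ (suc k) R (λ k<t t< → high⇒4≤a (high k<t (s≤s⁻¹ t<))))

      4R≤slots : 4 * R ≤ #slots
      4R≤slots = subst (4 * R ≤_) (sym #slots-split) (≤-trans 4R≤Σ (m≤m+n _ _))

      -- If a counted broadcast takes place right after the run, that slot adds at least 1 to the 4R
      -- broadcasts in the run. Otherwise `count-bound` applies with R - 1.
      2counted<slots : 2 * #counted + 1 ≤ #slots
      2counted<slots with any? (λ e → counted? e ×-dec (b e ≟ suc (k + R))) es
      ... | yes anyEnd = begin
        2 * #counted + 1
          ≤⟨ +-mono-≤ (*-monoʳ-≤ 2 (count-bound R λ {e} _ c → subst (b e ≤_) (sym (+-suc k R)) (proj₂ (proj₁ c)))) 1≤a ⟩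
        2 * (2 * R) + a (suc k + R)               ≡⟨ cong (_+ a (suc k + R)) (four R) ⟩
        4 * R + a (suc k + R)                     ≤⟨ +-monoˡ-≤ (a (suc k + R)) 4R≤Σ ⟩
        Σₗ (range (suc k) R) a + a (suc k + R)    ≡⟨ #slots-split ⟨
        #slots                                         ∎
        where
        open ≤-Reasoning
        four : ∀ R → 2 * (2 * R) ≡ 4 * R
        four = solve-∀
        1≤a : 1 ≤ a (suc k + R)
        1≤a = let e , e∈es , (_ , y≤) , be≡ = find anyEnd in subst (λ z → 1 ≤ a z) be≡ (own e∈es y≤)
      ... | no noEnd = begin
        2 * #counted + 1           ≤⟨ +-monoˡ-≤ 1 (*-monoʳ-≤ 2 (count-bound m b≤)) ⟩
        2 * (2 * m) + 1     ≤⟨ m≤m+n _ 3 ⟩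
        2 * (2 * m) + 1 + 3 ≡⟨ four m ⟩
        4 * suc m           ≡⟨ cong (4 *_) 1+m≡R ⟩
        4 * R               ≤⟨ 4R≤slots ⟩
        #slots                   ∎
        where
        open ≤-Reasoning
        m : ℕ
        m = pred R
        1+m≡R : suc m ≡ R
        1+m≡R = suc-pred R {{>-nonZero 0<R}}
        four : ∀ m → 2 * (2 * m) + 1 + 3 ≡ 4 * suc m
        four = solve-∀
        b≤ : ∀ {e} → e ∈ es → Counted e → b e ≤ k + suc m
        b≤ {e} e∈es c = subst (λ z → b e ≤ k + z) (sym 1+m≡R)
          (s≤s⁻¹ (≤∧≢⇒< (proj₂ (proj₁ c)) λ be≡ → noEnd (lose e∈es (c , be≡))))

      Starts : ∀ e u → Dec (0 < X e × o e ≡ u)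
      Starts e u = (0 <? X e) ×-dec (o e ≟ u)
      Ends : ∀ e t → Dec (0 < X e × b e ≡ t)
      Ends e t = (0 <? X e) ×-dec (b e ≟ t)
      Before : ∀ e ρ → Dec (0 < X e × o e + ρ ≡ suc k)
      Before e ρ = (0 <? X e) ×-dec (o e + ρ ≟ suc k)

      module _ (Z h : ℕ) (Z+h≡ : Z + h ≡ suc R) (52h≤ : 52 * h ≤ Z + h) where

        -- Three ways to pay for a broadcast: by its `o` inside the run, at price 5; by its distance
        -- `ρ` from `o` to the start of the run, at price `levels ρ Z`; by its slot among the last
        -- `h`, at price 1.
        inner outer late : E → ℕ
        inner e = Σₗ (range (suc k) R) (λ u → 5 * 𝟙 (Starts e u))
        late  e = Σₗ (range (suc (k + Z)) h) (λ t → 𝟙 (Ends e t))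
        outer e = Σₗ (range 1 R) (λ ρ → levels ρ Z * 𝟙 (Before e ρ))

        -- An `o` inside the run pays for all thresholds. Otherwise `levels-shift` leaves at most
        -- one threshold to the late slot and the rest to the distance.
        lev-bound : ∀ {e} → e ∈ es → 𝟙 (inRun? e) * lev y e ≤ inner e + (late e + outer e)
        lev-bound {e} e∈es = 𝟙*-≤ (inRun? e) (λ inRun → bound inRun (y ≤? 100 * X e) (o e ≤? k))
          where
          open ≤-Reasoning
          bound : InRun e → Dec (y ≤ 100 * X e) → Dec (o e ≤ k) → lev y e ≤ inner e + (late e + outer e)
          bound _ (no y≰) _ = subst (_≤ inner e + (late e + outer e)) (sym (lev≡0 e y≰)) z≤n
          bound (_ , b≤) (yes y≤) (no o≰k) = begin
            lev y e                     ≤⟨ lev≤5 e ⟩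
            5 * 1                       ≡⟨ cong (5 *_) (𝟙-yes (Starts e (o e)) (0<X , refl)) ⟨
            5 * 𝟙 (Starts e (o e))      ≤⟨ ∈⇒≤Σₗ (λ u → 5 * 𝟙 (Starts e u))
                                             (∈-range⁺ (≰⇒> o≰k) (<-≤-trans (o<b 0<X) b≤)) ⟩
            inner e                     ≤⟨ m≤m+n _ _ ⟩
            inner e + (late e + outer e) ∎
            where
            0<X : 0 < X e
            0<X = positive 100 y≤
          bound inRun@(1+k<b , b≤) (yes y≤) (yes o≤k) = begin
            lev y e
              ≤⟨ Σₗ-mono-∈ (upTo 5) (λ {i} i∈ → 𝟙-mono (y ≤? (100 ∸ i) * X e) (52 * ρ <? (52 ∸ i) * β)
                                             (reach e∈es inRun o≤k (∈-upTo⁻ i∈))) ⟩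
            levels ρ β                  ≤⟨ levels-shift ρ Z h 52h≤ (subst (β ≤_) (sym Z+h≡) β≤) ⟩
            𝟙 (Z <? β) + levels ρ Z     ≤⟨ +-mono-≤ (𝟙-≤ (Z <? β) is-late) is-outer ⟩
            late e + outer e            ≤⟨ m≤n+m _ (inner e) ⟩
            inner e + (late e + outer e) ∎
            where
            0<X : 0 < X e
            0<X = positive 100 y≤
            ρ β : ℕ
            ρ = suc k ∸ o e
            β = b e ∸ k
            k≤b : k ≤ b e
            k≤b = <⇒≤ (<-trans (n<1+n k) 1+k<b)
            β≤ : β ≤ suc R
            β≤ = m≤n+o⇒m∸n≤o (b e) k (subst (b e ≤_) (sym (+-suc k R)) b≤)
            ρ<β : ρ < β
            ρ<β = *-cancelˡ-< 52 _ _ (reach e∈es inRun o≤k {0} (s≤s z≤n) y≤)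
            is-late : Z < β → 1 ≤ late e
            is-late Z<β = begin
              1                  ≡⟨ 𝟙-yes (Ends e (b e)) (0<X , refl) ⟨
              𝟙 (Ends e (b e))   ≤⟨ ∈⇒≤Σₗ (λ t → 𝟙 (Ends e t)) (∈-range⁺ lower upper) ⟩
              late e             ∎
              where
              lower : suc (k + Z) ≤ b e
              lower = begin
                suc (k + Z)     ≡⟨ +-suc k Z ⟨
                k + suc Z       ≤⟨ +-monoʳ-≤ k Z<β ⟩
                k + β           ≡⟨ m+[n∸m]≡n k≤b ⟩
                b e             ∎
              upper : b e < suc (k + Z) + h
              upper = s≤s (begin
                b e             ≤⟨ b≤ ⟩
                suc (k + R)     ≡⟨ +-suc k R ⟨
                k + suc R       ≡⟨ cong (k +_) Z+h≡ ⟨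
                k + (Z + h)     ≡⟨ +-assoc k Z h ⟨
                k + Z + h       ∎)
            is-outer : levels ρ Z ≤ outer e
            is-outer = begin
              levels ρ Z                    ≡⟨ *-identityʳ _ ⟨
              levels ρ Z * 1
                ≡⟨ cong (levels ρ Z *_) (𝟙-yes (Before e ρ) (0<X , m+[n∸m]≡n (m≤n⇒m≤1+n o≤k))) ⟨
              levels ρ Z * 𝟙 (Before e ρ)   ≤⟨ ∈⇒≤Σₗ (λ ρ → levels ρ Z * 𝟙 (Before e ρ))
                                                 (∈-range⁺ (m<n⇒0<n∸m (s≤s o≤k)) (<-≤-trans ρ<β β≤)) ⟩
              outer e                       ∎

        Σ-inner : Σₗ es inner ≤ 5 * R
        Σ-inner = begin
          Σₗ es inner
            ≤⟨ Σₗ-charge es (range (suc k) R) (λ e u → 5 * 𝟙 (Starts e u)) (λ _ → 5)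
                                                     (λ _ → ≤-refl)
              (λ u → ≤-trans (≤-reflexive (Σₗ-* es 5 (λ e → 𝟙 (Starts e u))))
                             (*-monoʳ-≤ 5 (o-once u))) ⟩
          Σₗ (range (suc k) R) (λ _ → 5)         ≡⟨ Σₗ-const (range (suc k) R) 5 ⟩
          length (range (suc k) R) * 5           ≡⟨ cong (_* 5) (length-range (suc k) R) ⟩
          R * 5                                  ≡⟨ *-comm R 5 ⟩
          5 * R                                  ∎
          where open ≤-Reasoning

        -- Here the gain arises: replacing `Z` by Z + h in `Σ-levels` instead would cost 250h/52,
        -- which is more than 4.8h.
        Σ-late : Σₗ es late ≤ 4 * h
        Σ-late = begin
          Σₗ es late
            ≤⟨ Σₗ-charge es (range (suc (k + Z)) h) (λ e t → 𝟙 (Ends e t)) (λ _ → 4)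
                                                     (λ _ → ≤-refl) b-cap ⟩
          Σₗ (range (suc (k + Z)) h) (λ _ → 4)   ≡⟨ Σₗ-const (range (suc (k + Z)) h) 4 ⟩
          length (range (suc (k + Z)) h) * 4     ≡⟨ cong (_* 4) (length-range (suc (k + Z)) h) ⟩
          h * 4                                  ≡⟨ *-comm h 4 ⟩
          4 * h                                  ∎
          where open ≤-Reasoning

        Σ-outer : Σₗ es outer ≤ Σₗ (range 1 R) (λ ρ → levels ρ Z)
        Σ-outer = Σₗ-charge es (range 1 R) (λ e ρ → levels ρ Z * 𝟙 (Before e ρ)) (λ ρ → levels ρ Z)
          (λ _ → ≤-refl) λ ρ → begin
            Σₗ es (λ e → levels ρ Z * 𝟙 (Before e ρ))   ≡⟨ Σₗ-* es (levels ρ Z) (λ e → 𝟙 (Before e ρ)) ⟩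
            levels ρ Z * Σₗ es (λ e → 𝟙 (Before e ρ))   ≤⟨ *-monoʳ-≤ (levels ρ Z) (once ρ) ⟩
            levels ρ Z * 1                              ≡⟨ *-identityʳ _ ⟩
            levels ρ Z                                  ∎
          where
          open ≤-Reasoning
          once : ∀ ρ → Σₗ es (λ e → 𝟙 (Before e ρ)) ≤ 1
          once ρ = ≤-trans
            (Σₗ-mono es (λ e → 𝟙-mono (Before e ρ) (Starts e (suc k ∸ ρ))
              (λ (0<X , eq) → 0<X , trans (sym (m+n∸n≡m (o e) ρ)) (cong (_∸ ρ) eq))))
            (o-once (suc k ∸ ρ))

        Σlev-bound : 52 * Σlev ≤ 260 * R + 208 * h + 250 * Z
        Σlev-bound = begin
          52 * Σlev
            ≤⟨ *-monoʳ-≤ 52 (Σₗ-mono-∈ es lev-bound) ⟩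
          52 * Σₗ es (λ e → inner e + (late e + outer e))
            ≡⟨ cong (52 *_) (trans (Σₗ-+ es inner _) (cong (Σₗ es inner +_) (Σₗ-+ es late outer))) ⟩
          52 * (Σₗ es inner + (Σₗ es late + Σₗ es outer))
            ≤⟨ *-monoʳ-≤ 52 (+-mono-≤ Σ-inner (+-mono-≤ Σ-late Σ-outer)) ⟩
          52 * (5 * R + (4 * h + L))                           ≡⟨ expand R h L ⟩
          260 * R + 208 * h + 52 * L
            ≤⟨ +-monoʳ-≤ (260 * R + 208 * h) (Σ-levels Z R) ⟩
          260 * R + 208 * h + 250 * Z                          ∎
          where
          open ≤-Reasoning
          L : ℕ
          L = Σₗ (range 1 R) (λ ρ → levels ρ Z)
          expand : ∀ R h L → 52 * (5 * R + (4 * h + L)) ≡ 260 * R + 208 * h + 52 * L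
          expand = solve-∀

      run-split : ∀ e → 𝟙 (inRun? e) * weight y e ≤ 12 * 𝟙 (counted? e) + 𝟙 (inRun? e) * lev y e
      run-split e = 𝟙*-≤ (inRun? e) λ inRun → +-mono-≤
        (*-monoʳ-≤ 12 (𝟙-mono (y ≤? 100 * X e) (counted? e) (inRun ,_)))
        (≤-𝟙* (inRun? e) (lev y e) inRun)

      run-weight : Σₗ es (λ e → 𝟙 (inRun? e) * weight y e) ≤ 12 * #counted + Σlev
      run-weight = ≤-trans (Σₗ-mono es run-split) (≤-reflexive (trans
        (Σₗ-+ es (λ e → 12 * 𝟙 (counted? e)) (λ e → 𝟙 (inRun? e) * lev y e))
        (cong (_+ Σlev) (Σₗ-* es 12 (λ e → 𝟙 (counted? e))))))

      run-bound : Σₗ es (λ e → 𝟙 (inRun? e) * weight y e) ≼ #slots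
      run-bound = let Z , h , Z+h≡ , 52h≤ , R≤ = fifty-second R in
        ≼-resp-≤ run-weight ≤-refl
          (combine {#counted} {Σlev} {#slots} {R} {Z} {h} Z+h≡ R≤ 4R≤slots 2counted<slots (Σlev-bound Z h Z+h≡ 52h≤))

    -- Splitting the time axis into runs

    run-start : ∀ r → High (suc r) → ¬ High 0 →
      ∃[ k ] ∃[ R ] 0 < R × k + R ≡ suc r × ¬ High k × (∀ {t} → k < t → t ≤ k + R → High t)
    run-start r hr ¬h0 with high? r
    run-start r hr ¬h0 | no ¬hr = r , 1 , s≤s z≤n , +-comm r 1 , ¬hr ,
      λ r<t t≤ → subst High (≤-antisym r<t (≤-trans t≤ (≤-reflexive (+-comm r 1)))) hr
    run-start zero    hr ¬h0 | yes h = contradiction h ¬h0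
    run-start (suc r) hr ¬h0 | yes h with run-start r h ¬h0
    ... | k , R , 0<R , k+R≡ , low , high = k , suc R , s≤s z≤n , trans (+-suc k R) (cong suc k+R≡) , low ,
      λ {t} k<t t≤ → extend k<t (m≤n⇒m<n∨m≡n t≤)
      where
      extend : ∀ {t} → k < t → t < k + suc R ⊎ t ≡ k + suc R → High t
      extend {t} k<t (inj₁ t<) = high k<t (s≤s⁻¹ (subst (t <_) (+-suc k R) t<))
      extend k<t (inj₂ refl)   = subst High (sym (trans (+-suc k R) (cong suc k+R≡))) hr

    -- A covering ramp has X > 0 and hence o > 0, so it has not started at time 0. Thus a low time
    -- precedes every run.
    ¬high-0 : ¬ High 0
    ¬high-0 h with find h
    ... | e , _ , o≤0 , 0<b , y*≤ = <⇒≱ (0<o 0<X) o≤0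
      where
      0<X : 0 < X e
      0<X with X e
      ... | suc _ = s≤s z≤n
      ... | zero  = contradiction (<-≤-trans (*-mono-< 0<y (m<n⇒0<n∸m (s≤s (≤-trans o≤0 z≤n)))) y*≤) λ ()

    low⇒weight≡0 : ∀ {e r} → e ∈ es → ¬ High r → b e ≡ suc r → weight y e ≡ 0
    low⇒weight≡0 {e} e∈es low be≡ = weight≡0 e (λ y≤ → low (lose e∈es (covers-last y≤ be≡)))

    up-to : ℕ → E → ℕ
    up-to T e = 𝟙 (b e ≤? T) * weight y e

    -- Strong induction on T, splitting off the run of high times that ends at T ∸ 1.
    weight-bound : ∀ T → Σₗ es (up-to T) ≼ Σₗ (range 0 (suc T)) a
    weight-bound = <-rec _ step
      where
      open ≤-Reasoning

      zero-step : ∀ e → up-to 0 e ≤ 0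
      zero-step e = 𝟙*-≤ (b e ≤? 0) λ b≤0 → ≤-reflexive (weight≡0 e λ y≤ →
        <⇒≱ (<-≤-trans (o<b (positive 100 y≤)) b≤0) z≤n)

      low-step : ∀ {r} → ¬ High r → ∀ {e} → e ∈ es → up-to (suc r) e ≤ up-to r e
      low-step {r} low {e} e∈es = 𝟙*-≤ (b e ≤? suc r) λ b≤ → split (m≤n⇒m<n∨m≡n b≤)
        where
        split : b e < suc r ⊎ b e ≡ suc r → weight y e ≤ up-to r e
        split (inj₁ b<) = ≤-𝟙* (b e ≤? r) (weight y e) (s≤s⁻¹ b<)
        split (inj₂ b≡) = subst (_≤ up-to r e) (sym (low⇒weight≡0 e∈es low b≡)) z≤n

      run-step : ∀ {k R} (0<R : 0 < R) (low : ¬ High k) (high : ∀ {t} → k < t → t ≤ k + R → High t) →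
        Σₗ es (up-to k) ≼ Σₗ (range 0 (suc k)) a →
        Σₗ es (up-to (suc (k + R))) ≼ Σₗ (range 0 (suc (suc (k + R)))) a
      run-step {k} {R} 0<R low high ih = ≼-resp-≤ before+run times (≼-+ ih run-bound)
        where
        open Run k R 0<R low high
        split : ∀ {e} → e ∈ es → up-to (suc (k + R)) e ≤ up-to k e + 𝟙 (inRun? e) * weight y e
        split {e} e∈es = 𝟙*-≤ (b e ≤? suc (k + R)) λ b≤ → cases b≤ (<-cmp (b e) (suc k))
          where
          cases : b e ≤ suc (k + R) → Tri (b e < suc k) (b e ≡ suc k) (suc k < b e) →
                  weight y e ≤ up-to k e + 𝟙 (inRun? e) * weight y e
          cases _  (tri< b< _ _)    = ≤-trans (≤-𝟙* (b e ≤? k) (weight y e) (s≤s⁻¹ b<)) (m≤m+n _ _)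
          -- Such a broadcast directly follows the low time `k`.
          cases _  (tri≈ _ b≡ _)    = ≤-trans (≤-reflexive (low⇒weight≡0 e∈es low b≡)) z≤n
          cases b≤ (tri> _ _ 1+k<b) = ≤-trans (≤-𝟙* (inRun? e) (weight y e) (1+k<b , b≤)) (m≤n+m _ (up-to k e))
        before+run : Σₗ es (up-to (suc (k + R))) ≤ Σₗ es (up-to k) + Σₗ es (λ e → 𝟙 (inRun? e) * weight y e)
        before+run = ≤-trans (Σₗ-mono-∈ es split)
          (≤-reflexive (Σₗ-+ es (up-to k) (λ e → 𝟙 (inRun? e) * weight y e)))
        times : Σₗ (range 0 (suc k)) a + #slots ≤ Σₗ (range 0 (suc (suc (k + R)))) a
        times = ≤-reflexive (trans (sym (Σₗ-range-+ 0 (suc k) (suc R) a))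
          (cong (λ m → Σₗ (range 0 (suc m)) a) (+-suc k R)))

      step : ∀ T → (∀ {S} → S < T → Σₗ es (up-to S) ≼ Σₗ (range 0 (suc S)) a) →
             Σₗ es (up-to T) ≼ Σₗ (range 0 (suc T)) a
      step zero    ih = 0≼ _ (≤-trans (Σₗ-mono es zero-step) (≤-reflexive (Σₗ-zero es)))
      step (suc r) ih with high? r
      ... | no low = ≼-resp-≤ (Σₗ-mono-∈ es (low-step low)) times (ih ≤-refl)
        where
        times : Σₗ (range 0 (suc r)) a ≤ Σₗ (range 0 (suc (suc r))) a
        times = begin
          Σₗ (range 0 (suc r)) a                                ≤⟨ m≤m+n _ _ ⟩
          Σₗ (range 0 (suc r)) a + Σₗ (range (suc r) 1) a       ≡⟨ Σₗ-range-+ 0 (suc r) 1 a ⟨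
          Σₗ (range 0 (suc r + 1)) a
            ≡⟨ cong (λ m → Σₗ (range 0 m) a) (+-comm (suc r) 1) ⟩
          Σₗ (range 0 (suc (suc r))) a                          ∎
      step (suc zero)    ih | yes h = contradiction h ¬high-0
      step (suc (suc r)) ih | yes h with run-start r h ¬high-0
      ... | k , R , 0<R , k+R≡ , low , high =
        subst (λ m → Σₗ es (up-to (suc m)) ≼ Σₗ (range 0 (suc (suc m))) a) k+R≡
          (run-step 0<R low high (ih (s≤s (≤-trans (subst (k ≤_) k+R≡ (m≤m+n k R)) ≤-refl))))

  -- Summation over the levels turns each threshold into its value: 12 · 100 + 100 + 99 + 98 + 97 +
  -- 96 = 1690.
  weight-total : ∀ e Y → 100 * X e ≤ Y → 1690 * X e ≤ Σₗ (range 1 Y) (λ y → weight y e)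
  weight-total e Y 100X≤Y = begin
    1690 * X e
      ≡⟨ expand (X e) ⟩
    12 * (100 * X e) + Σₗ (upTo 5) (λ i → (100 ∸ i) * X e)
      ≤⟨ +-mono-≤ (*-monoʳ-≤ 12 (count-≥ (100 * X e) Y 100X≤Y))
           (Σₗ-mono (upTo 5) (λ i → count-≥ ((100 ∸ i) * X e) Y
              (≤-trans (*-monoˡ-≤ (X e) (m∸n≤m 100 i)) 100X≤Y))) ⟩
    12 * Σₗ (range 1 Y) (λ y → 𝟙 (y ≤? 100 * X e)) +
      Σₗ (upTo 5) (λ i → Σₗ (range 1 Y) (λ y → 𝟙 (y ≤? (100 ∸ i) * X e)))
      ≡⟨ cong₂ _+_ (Σₗ-* (range 1 Y) 12 (λ y → 𝟙 (y ≤? 100 * X e)))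
                   (Σₗ-swap (range 1 Y) (upTo 5) (λ y i → 𝟙 (y ≤? (100 ∸ i) * X e))) ⟨
    Σₗ (range 1 Y) (λ y → 12 * 𝟙 (y ≤? 100 * X e)) + Σₗ (range 1 Y) (λ y → lev y e)
      ≡⟨ Σₗ-+ (range 1 Y) (λ y → 12 * 𝟙 (y ≤? 100 * X e)) (λ y → lev y e) ⟨
    Σₗ (range 1 Y) (λ y → weight y e) ∎
    where
    open ≤-Reasoning
    expand : ∀ x → 1690 * x ≡ 12 * (100 * x) + (100 * x + (99 * x + (98 * x + (97 * x + (96 * x + 0)))))
    expand = solve-∀

  -- The bounds of the single levels are added; above level 100 ΣX no broadcast has weight.
  charging : ∀ T (a : ℕ → ℕ → ℕ) → (∀ {e} → e ∈ es → b e ≤ T) →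
    (∀ {y e t} → 0 < y → e ∈ es → Covers y t e → 4 ≤ a y t) →
    (∀ {y e} → 0 < y → e ∈ es → y ≤ 100 * X e → 1 ≤ a y (b e)) →
    1690 * Σₗ es X ≼ Σₗ (range 1 (100 * Σₗ es X)) (λ y → Σₗ (range 0 (suc T)) (a y))
  charging T a b≤T busy own = ≼-resp-≤ lower ≤-refl
    (≼-Σₗ (range 1 Y) (λ {y} y∈ → let 0<y = proj₁ (∈-range⁻ Y y∈) in
      Level.weight-bound y 0<y (a y) (busy 0<y) (own 0<y) T))
    where
    open ≤-Reasoning
    Y : ℕ
    Y = 100 * Σₗ es X
    up-to : ℕ → E → ℕ
    up-to y e = 𝟙 (b e ≤? T) * weight y e
    lower : 1690 * Σₗ es X ≤ Σₗ (range 1 Y) (λ y → Σₗ es (up-to y))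
    lower = begin
      1690 * Σₗ es X                                ≡⟨ Σₗ-* es 1690 X ⟨
      Σₗ es (λ e → 1690 * X e)
        ≤⟨ Σₗ-mono-∈ es (λ {e} e∈es → ≤-trans
             (weight-total e Y (*-monoʳ-≤ 100 (∈⇒≤Σₗ X e∈es)))
             (Σₗ-mono (range 1 Y) (λ y → ≤-𝟙* (b e ≤? T) (weight y e) (b≤T e∈es)))) ⟩
      Σₗ es (λ e → Σₗ (range 1 Y) (λ y → up-to y e))  ≡⟨ Σₗ-swap es (range 1 Y) (λ e y → up-to y e) ⟩
      Σₗ (range 1 Y) (λ y → Σₗ es (up-to y))          ∎

-- Requests and schedules

𝟙-∈?-suc : ∀ {n x} (s : Subset n) p → 𝟙 (suc p ∈? (x ∷ s)) ≡ 𝟙 (p ∈? s)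
𝟙-∈?-suc {x = x} s p = ≤-antisym (𝟙-mono (suc p ∈? (x ∷ s)) (p ∈? s) drop-there)
                                 (𝟙-mono (p ∈? s) (suc p ∈? (x ∷ s)) there)

sum-𝟙-∈? : ∀ {n} (s : Subset n) → sum (λ p → 𝟙 (p ∈? s)) ≡ ∣ s ∣
sum-𝟙-∈? []            = refl
sum-𝟙-∈? (inside ∷ s)  =
  cong₂ _+_ (𝟙-yes (zero ∈? (inside ∷ s)) here) (trans (sum-cong-≗ (𝟙-∈?-suc s)) (sum-𝟙-∈? s))
sum-𝟙-∈? (outside ∷ s) =
  cong₂ _+_ (𝟙-no (zero ∈? (outside ∷ s)) λ ()) (trans (sum-cong-≗ (𝟙-∈?-suc s)) (sum-𝟙-∈? s))

∣∣≡Σₗ : ∀ {n} (s : Subset n) → ∣ s ∣ ≡ Σₗ (allFin n) (λ p → 𝟙 (p ∈? s))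
∣∣≡Σₗ s = trans (sym (sum-𝟙-∈? s)) (sum≡Σₗ (λ p → 𝟙 (p ∈? s)))

0<∣∣⇒nonempty : ∀ {n} (s : Subset n) → 0 < ∣ s ∣ → ∃[ p ] p ∈ₛ s
0<∣∣⇒nonempty {n} s 0<s =
  let p , _ , 0<𝟙 = Σₗ-positive (allFin n) (λ p → 𝟙 (p ∈? s)) (subst (0 <_) (∣∣≡Σₗ s) 0<s)
  in p , 𝟙-positive (p ∈? s) 0<𝟙

∈⇒0<∣∣ : ∀ {n} (s : Subset n) {p} → p ∈ₛ s → 0 < ∣ s ∣
∈⇒0<∣∣ {n} s {p} p∈s = begin
  1                                   ≡⟨ 𝟙-yes (p ∈? s) p∈s ⟨
  𝟙 (p ∈? s)                          ≤⟨ ∈⇒≤Σₗ (λ p → 𝟙 (p ∈? s)) (∈-allFin p) ⟩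
  Σₗ (allFin n) (λ p → 𝟙 (p ∈? s))    ≡⟨ ∣∣≡Σₗ s ⟨
  ∣ s ∣                               ∎
  where open ≤-Reasoning

∣∣≤1⇒≡ : ∀ {n} (s : Subset n) {p q} → ∣ s ∣ ≤ 1 → p ∈ₛ s → q ∈ₛ s → p ≡ q
∣∣≤1⇒≡ (_ ∷ s)       _        here       here       = refl
∣∣≤1⇒≡ (inside ∷ s)  (s≤s ≤0) here       (there q∈) = contradiction (∈⇒0<∣∣ s q∈) (≤⇒≯ ≤0)
∣∣≤1⇒≡ (inside ∷ s)  (s≤s ≤0) (there p∈) _          = contradiction (∈⇒0<∣∣ s p∈) (≤⇒≯ ≤0)
∣∣≤1⇒≡ (outside ∷ s) ≤1       (there p∈) (there q∈) = cong suc (∣∣≤1⇒≡ s ≤1 p∈ q∈)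

module _ {n : ℕ} (R : Requests n) where

  Σᵣ : ((p : Fin n) → Fin (count R p) → ℕ) → ℕ
  Σᵣ f = Σₗ (allFin n) (λ p → Σₗ (allFin (count R p)) (f p))

  sum≡Σᵣ : ∀ f → (∑[ p < n ] ∑[ i < count R p ] f p i) ≡ Σᵣ f
  sum≡Σᵣ f = trans (sum≡Σₗ (λ p → sum (f p))) (Σₗ-cong (allFin n) (λ p → sum≡Σₗ (f p)))

  Σᵣ-mono : ∀ {f g : (p : Fin n) → Fin (count R p) → ℕ} → (∀ p i → f p i ≤ g p i) → Σᵣ f ≤ Σᵣ g
  Σᵣ-mono f≤g = Σₗ-mono (allFin n) (λ p → Σₗ-mono (allFin (count R p)) (f≤g p))

  Σᵣ-+ : ∀ (f g : (p : Fin n) → Fin (count R p) → ℕ) → Σᵣ (λ p i → f p i + g p i) ≡ Σᵣ f + Σᵣ g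
  Σᵣ-+ f g = trans (Σₗ-cong (allFin n) (λ p → Σₗ-+ (allFin (count R p)) (f p) (g p)))
                   (Σₗ-+ (allFin n) (λ p → Σₗ (allFin (count R p)) (f p)) (λ p → Σₗ (allFin (count R p)) (g p)))

  ≤Σᵣ : ∀ f p i → f p i ≤ Σᵣ f
  ≤Σᵣ f p i = ≤-trans (∈⇒≤Σₗ (f p) (∈-allFin i))
                      (∈⇒≤Σₗ (λ p → Σₗ (allFin (count R p)) (f p)) (∈-allFin p))

  Σᵣ-swap : ∀ (ts : List ℕ) (f : ℕ → (p : Fin n) → Fin (count R p) → ℕ) →
            Σₗ ts (λ t → Σᵣ (f t)) ≡ Σᵣ (λ p i → Σₗ ts (λ t → f t p i))
  Σᵣ-swap ts f = trans (Σₗ-swap ts (allFin n) (λ t p → Σₗ (allFin (count R p)) (f t p)))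
                       (Σₗ-cong (allFin n) (λ p → Σₗ-swap ts (allFin (count R p)) (λ t i → f t p i)))

  waiting : Schedule n → ℕ → Fin n → ℕ
  waiting σ t p = Σₗ (allFin (count R p)) (λ i → 𝟙 (outstanding? R σ t p i) * (t ∸ arrival R p i))

  waitingTime≡waiting : ∀ σ t p → waitingTime R σ t p ≡ waiting σ t p
  waitingTime≡waiting σ t p = trans
    (sum-cong-≗ (λ i → if≡𝟙* (outstanding? R σ t p i) (t ∸ arrival R p i)))
    (sum≡Σₗ (λ i → 𝟙 (outstanding? R σ t p i) * (t ∸ arrival R p i)))

  outstanding-earlier : ∀ {σ s t p i} → s ≤ t → arrival R p i < s → Outstanding R σ t p i → Outstanding R σ s p i
  outstanding-earlier s≤t a<s (_ , unserved) = a<s , λ u<s → unserved (<-≤-trans u<s s≤t)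

  -- LWF finishes every request

  module _ {σ : Schedule n} (lwf : IsLWF R 4 σ) where
    open IsLWF lwf

    -- Unlike `Outstanding`, this includes requests yet to arrive, so that `#unserved` never grows.
    Unserved : ℕ → (p : Fin n) → Fin (count R p) → Set
    Unserved t p i = ∀ {u} → u < t → arrival R p i < u → p ∉ₛ σ u

    unserved? : ∀ t p i → Dec (Unserved t p i)
    unserved? t p i = allUpTo? (λ u → (arrival R p i <? u) →-dec ¬? (p ∈? σ u)) t

    #unserved : ℕ → ℕ
    #unserved t = Σᵣ (λ p i → 𝟙 (unserved? t p i))

    saturated : ∀ {t p i} → Outstanding R σ t p i → p ∉ₛ σ t → 4 ≤ ∣ σ t ∣
    saturated out p∉ = ≮⇒≥ (λ <4 → p∉ (full <4 out))

    broadcast-serves : ∀ {t q} → q ∈ₛ σ t → #unserved (suc t) < #unserved t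
    broadcast-serves {t} {q} q∈ =
      let j , a<t , unserved = pending q∈ in
      Σₗ-strict (∈-allFin q) (λ p → Σₗ-mono (allFin (count R p)) (shrink p))
        (Σₗ-strict (∈-allFin j) (shrink q)
          (subst₂ _<_ (sym (𝟙-no (unserved? (suc t) q j) (λ later → later ≤-refl a<t q∈)))
                      (sym (𝟙-yes (unserved? t q j) unserved)) (s≤s z≤n)))
      where
      shrink : ∀ p i → 𝟙 (unserved? (suc t) p i) ≤ 𝟙 (unserved? t p i)
      shrink p i = 𝟙-mono (unserved? (suc t) p i) (unserved? t p i) (λ un u<t → un (m≤n⇒m≤1+n u<t))

    -- While the request waits, LWF is saturated and so broadcasts some page, which lowers
    -- `#unserved`. The induction is on the bound `m`.
    eventually-served : ∀ m {t p i} → #unserved t < m → Outstanding R σ t p i → ∃[ f ] IsFinishTime R σ p i f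
    eventually-served (suc m) {t} {p} {i} <m out@(a<t , unserved) with p ∈? σ t
    ... | yes p∈ = t , record
      { after     = a<t
      ; broadcast = p∈
      ; earliest  = λ a<u p∈u → ≮⇒≥ (λ u<t → unserved u<t a<u p∈u)
      }
    ... | no p∉ =
      let q , q∈ = 0<∣∣⇒nonempty (σ t) (<-≤-trans (s≤s z≤n) (saturated out p∉)) in
      eventually-served m (<-≤-trans (broadcast-serves q∈) (s≤s⁻¹ <m))
        (m≤n⇒m≤1+n a<t , λ u<1+t → later (m≤n⇒m<n∨m≡n (s≤s⁻¹ u<1+t)))
      where
      later : ∀ {u} → u < t ⊎ u ≡ t → arrival R p i < u → p ∉ₛ σ u
      later (inj₁ u<t)  = unserved u<t
      later (inj₂ refl) _ = p∉

    lwf-finishes : ∀ p i → ∃[ f ] IsFinishTime R σ p i f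
    lwf-finishes p i = eventually-served (suc (#unserved (suc (arrival R p i)))) ≤-refl
      -- At a + 1 the condition is vacuous: no `u` satisfies a < u < a + 1.
      (≤-refl , λ u<1+a a<u → contradiction a<u (≤⇒≯ (s≤s⁻¹ u<1+a)))

-- 0 if p is not broadcast before t.
lastBefore : ∀ {n} → Schedule n → Fin n → ℕ → ℕ
lastBefore σ p zero    = 0
lastBefore σ p (suc t) with p ∈? σ t
... | yes _ = t
... | no  _ = lastBefore σ p t

lastBefore-upper : ∀ {n} (σ : Schedule n) p t {u} → u < t → p ∈ₛ σ u → u ≤ lastBefore σ p t
lastBefore-upper σ p (suc t) u<1+t p∈ with p ∈? σ t
... | yes _ = s≤s⁻¹ u<1+t
... | no p∉ with m≤n⇒m<n∨m≡n (s≤s⁻¹ u<1+t)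
...   | inj₁ u<t  = lastBefore-upper σ p t u<t p∈
...   | inj₂ refl = contradiction p∈ p∉

lastBefore-∈ : ∀ {n} (σ : Schedule n) p t → 0 < lastBefore σ p t →
               p ∈ₛ σ (lastBefore σ p t) × lastBefore σ p t < t
lastBefore-∈ σ p (suc t) 0<l with p ∈? σ t
... | yes p∈ = p∈ , ≤-refl
... | no _   = let p∈ , l<t = lastBefore-∈ σ p t 0<l in p∈ , m≤n⇒m≤1+n l<t

-- The ramp starts from 0 at o ∸ 1 rather than at o: every arrival before o has happened by then.
ramp : ∀ {a o t b} → a < o → o ≤ t → t ≤ b → (b ∸ a) * (suc t ∸ o) ≤ (t ∸ a) * (suc b ∸ o)
ramp {a} a<o o≤t t≤b with m≤n⇒∃[o]m+o≡n a<o
... | d , refl with m≤n⇒∃[o]m+o≡n o≤t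
...   | j , refl with m≤n⇒∃[o]m+o≡n t≤b
...     | k , refl = subst₂ _≤_ (cong₂ _*_ (sym b∸a) (sym 1+t∸o)) (cong₂ _*_ (sym t∸a) (sym 1+b∸o)) (begin
  -- With d = o - a - 1, j = t - o and k = b - t the two sides differ by exactly kd.
  (suc d + j + k) * suc j                  ≤⟨ m≤m+n _ (k * d) ⟩
  (suc d + j + k) * suc j + k * d          ≡⟨ expand d j k ⟩
  (suc d + j) * suc (j + k)                ∎)
  where
  open ≤-Reasoning
  expand : ∀ d j k → (suc d + j + k) * suc j + k * d ≡ (suc d + j) * suc (j + k)
  expand = solve-∀
  drop : ∀ m n {z} → z ≡ m + n → z ∸ m ≡ n
  drop m n refl = m+n∸m≡n m n
  b∸a : suc a + d + j + k ∸ a ≡ suc d + j + k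
  b∸a = drop a (suc d + j + k) (e a d j k)
    where
    e : ∀ a d j k → suc a + d + j + k ≡ a + (suc d + j + k)
    e = solve-∀
  t∸a : suc a + d + j ∸ a ≡ suc d + j
  t∸a = drop a (suc d + j) (e a d j)
    where
    e : ∀ a d j → suc a + d + j ≡ a + (suc d + j)
    e = solve-∀
  1+t∸o : suc (suc a + d + j) ∸ (suc a + d) ≡ suc j
  1+t∸o = drop (suc a + d) (suc j) (sym (+-suc (suc a + d) j))
  1+b∸o : suc (suc a + d + j + k) ∸ (suc a + d) ≡ suc (j + k)
  1+b∸o = drop (suc a + d) (suc (j + k)) (e (suc a + d) j k)
    where
    e : ∀ o j k → suc (o + j + k) ≡ o + suc (j + k)
    e = solve-∀

-- Comparison of LWF with a schedule of speed 1

-- The slack is 5408 · 1690 - 45687 · 200 = 2120, and 4312 is 5408 · 1690/2120 rounded up.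
absorb : ∀ {L O X Q} → L ≤ O + X → 1690 * X ≼ Q → Q ≤ 200 * L → L ≤ 4312 * O
absorb {L} {O} {X} {Q} L≤ X≼ Q≤ = *-cancelˡ-≤ 2120 (+-cancelʳ-≤ (45687 * (200 * L)) (2120 * L) (2120 * (4312 * O)) (begin
  2120 * L + 45687 * (200 * L)                 ≡⟨ e₁ L ⟩
  5408 * (1690 * L)                            ≤⟨ *-monoʳ-≤ 5408 (*-monoʳ-≤ 1690 L≤) ⟩
  5408 * (1690 * (O + X))                      ≡⟨ e₂ O X ⟩
  5408 * 1690 * O + 5408 * (1690 * X)
    ≤⟨ +-mono-≤ (*-monoˡ-≤ O (≤ᵇ⇒≤ (5408 * 1690) (2120 * 4312) _))
                                                           (≤-trans (≼⇒≤ X≼) (*-monoʳ-≤ 45687 Q≤)) ⟩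
  2120 * 4312 * O + 45687 * (200 * L)          ≡⟨ cong (_+ 45687 * (200 * L)) (*-assoc 2120 4312 O) ⟩
  2120 * (4312 * O) + 45687 * (200 * L)        ∎))
  where
  open ≤-Reasoning
  e₁ : ∀ L → 2120 * L + 45687 * (200 * L) ≡ 5408 * (1690 * L)
  e₁ L = trans (cong (2120 * L +_) (sym (*-assoc 45687 200 L)))
        (trans (sym (*-distribʳ-+ L 2120 (45687 * 200)))
        (trans (cong (_* L) {2120 + 45687 * 200} {5408 * 1690} refl) (*-assoc 5408 1690 L)))
  e₂ : ∀ O X → 5408 * (1690 * (O + X)) ≡ 5408 * 1690 * O + 5408 * (1690 * X)
  e₂ O X = trans (cong (5408 *_) (*-distribˡ-+ 1690 O X))
          (trans (*-distribˡ-+ 5408 (1690 * O) (1690 * X))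
                 (cong (_+ 5408 * (1690 * X)) (sym (*-assoc 5408 1690 O))))

module Competitive {n : ℕ} (R : Requests n) {σ σ* : Schedule n} (lwf : IsLWF R 4 σ) (speed* : HasSpeed 1 σ*)
  {f f* : (p : Fin n) → Fin (count R p) → ℕ}
  (finish  : ∀ p i → IsFinishTime R σ p i (f p i))
  (finish* : ∀ p i → IsFinishTime R σ* p i (f* p i)) where

  open IsLWF lwf

  private
    a : (p : Fin n) → Fin (count R p) → ℕ
    a = arrival R

  flow flow* : (p : Fin n) → Fin (count R p) → ℕ
  flow  p i = f p i ∸ a p i
  flow* p i = f* p i ∸ a p i

  -- A crude horizon: no finish time exceeds the sum of all.
  T : ℕ
  T = Σᵣ R f

  times : List ℕ
  times = range 0 (suc T)

  events : List (ℕ × Fin n)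
  events = cartesianProduct times (allFin n)

  o b X : ℕ × Fin n → ℕ
  early? : ∀ t p i → Dec (Outstanding R σ t p i × a p i < o (t , p))

  o (t , p) = lastBefore σ* p t
  b (t , p) = t
  early? t p i = outstanding? R σ t p i ×-dec (a p i <? o (t , p))
  X (t , p) = 𝟙 (p ∈? σ t) * Σₗ (allFin (count R p)) (λ i → 𝟙 (early? t p i) * (t ∸ a p i))

  X-witness : ∀ {t p} → 0 < X (t , p) → p ∈ₛ σ t × ∃[ i ] Outstanding R σ t p i × a p i < o (t , p)
  X-witness {t} {p} 0<X =
    let p∈ , 0<Σ = 𝟙*-positive (p ∈? σ t) 0<X
        i , _ , 0<term = Σₗ-positive (allFin (count R p)) (λ i → 𝟙 (early? t p i) * (t ∸ a p i)) 0<Σ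
    in p∈ , i , proj₁ (𝟙*-positive (early? t p i) 0<term)

  0<o : ∀ {e} → 0 < X e → 0 < o e
  0<o 0<X = let _ , _ , _ , a<o = X-witness 0<X in ≤-<-trans z≤n a<o

  o-broadcast : ∀ {t p} → 0 < X (t , p) → p ∈ₛ σ* (o (t , p)) × o (t , p) < t
  o-broadcast {t} {p} 0<X = lastBefore-∈ σ* p t (0<o 0<X)

  -- Equal `o` force equal pages by the speed of `σ*`; equal times then follow from `ordered`.
  o-injective : ∀ {e e′} → 0 < X e → 0 < X e′ → o e ≡ o e′ → e ≡ e′
  o-injective {t , p} {t′ , p′} 0<X 0<X′ o≡o′ = same-page (∣∣≤1⇒≡ (σ* (o (t , p))) (speed* (o (t , p)))
    (proj₁ (o-broadcast 0<X)) (subst (λ u → p′ ∈ₛ σ* u) (sym o≡o′) (proj₁ (o-broadcast 0<X′))))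
    where
    -- The earlier broadcast of p would already have served what waits at the later one.
    ordered : ∀ {s t p} → 0 < X (s , p) → 0 < X (t , p) → o (s , p) ≡ o (t , p) → ¬ s < t
    ordered 0<Xs 0<Xt o≡ s<t =
      let p∈ , _ = X-witness 0<Xs
          _ , i , (_ , unserved) , a<o = X-witness 0<Xt
      in unserved s<t (<-trans (subst (_ <_) (sym o≡) a<o) (proj₂ (o-broadcast 0<Xs))) p∈
    same-page : p ≡ p′ → (t , p) ≡ (t′ , p′)
    same-page refl with <-cmp t t′
    ... | tri< t<t′ _ _ = contradiction t<t′ (ordered 0<X 0<X′ o≡o′)
    ... | tri≈ _ refl _ = refl
    ... | tri> _ _ t′<t = contradiction t′<t (ordered 0<X′ 0<X (sym o≡o′))

  o-once : ∀ u → Σₗ events (λ e → 𝟙 ((0 <? X e) ×-dec (o e ≟ u))) ≤ 1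
  o-once u = Σₗ-single (cartesianProduct⁺ (range-unique 0 (suc T)) (allFin⁺ n))
    (λ {e} {e′} p q →
      let 0<X , o≡u   = 𝟙-positive ((0 <? X e) ×-dec (o e ≟ u)) p
          0<X′ , o′≡u = 𝟙-positive ((0 <? X e′) ×-dec (o e′ ≟ u)) q
      in o-injective 0<X 0<X′ (trans o≡u (sym o′≡u)))
    (λ e → 𝟙-≤ ((0 <? X e) ×-dec (o e ≟ u)) (λ _ → ≤-refl))

  b-cap : ∀ t → Σₗ events (λ e → 𝟙 ((0 <? X e) ×-dec (b e ≟ t))) ≤ 4
  b-cap t = begin
    Σₗ events (λ e → 𝟙 (ends? e))
      ≡⟨ Σₗ-cartesianProduct times (allFin n) (λ e → 𝟙 (ends? e)) ⟩
    Σₗ times (λ s → Σₗ (allFin n) (λ p → 𝟙 (ends? (s , p))))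
      ≡⟨ Σₗ-swap times (allFin n) (λ s p → 𝟙 (ends? (s , p))) ⟩
    Σₗ (allFin n) (λ p → Σₗ times (λ s → 𝟙 (ends? (s , p))))   ≤⟨ Σₗ-mono (allFin n) at-t ⟩
    Σₗ (allFin n) (λ p → 𝟙 (p ∈? σ t))                         ≡⟨ ∣∣≡Σₗ (σ t) ⟨
    ∣ σ t ∣                                                    ≤⟨ speed t ⟩
    4                                                          ∎
    where
    open ≤-Reasoning
    ends? : ∀ e → Dec (0 < X e × b e ≡ t)
    ends? e = (0 <? X e) ×-dec (b e ≟ t)
    at-t : ∀ p → Σₗ times (λ s → 𝟙 (ends? (s , p))) ≤ 𝟙 (p ∈? σ t)
    at-t p = Σₗ-single (range-unique 0 (suc T))
      (λ {s} {s′} h h′ → trans (proj₂ (𝟙-positive (ends? (s , p)) h)) (sym (proj₂ (𝟙-positive (ends? (s′ , p)) h′))))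
      (λ s → 𝟙-mono (ends? (s , p)) (p ∈? σ t) (λ { (0<X , refl) → proj₁ (X-witness 0<X) }))

  open Charging events o b X 0<o (λ 0<X → proj₂ (o-broadcast 0<X)) o-once b-cap

  -- Ramps and heavy broadcasts

  heavy? : ∀ y t p → Dec (p ∈ₛ σ t × y ≤ 200 * waiting R σ t p)
  heavy? y t p = (p ∈? σ t) ×-dec (y ≤? 200 * waiting R σ t p)

  #heavy : ℕ → ℕ → ℕ
  #heavy y t = Σₗ (allFin n) (λ p → 𝟙 (heavy? y t p))

  -- Every request counted in `X` is already waiting at `s`, and `ramp` applies to each of them
  -- separately.
  X-ramp : ∀ {t p s} → o (t , p) ≤ s → s ≤ t →
           X (t , p) * (suc s ∸ o (t , p)) ≤ waiting R σ s p * (suc t ∸ o (t , p))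
  X-ramp {t} {p} {s} o≤s s≤t = begin
    X (t , p) * K                 ≤⟨ *-monoˡ-≤ K (𝟙*-≤ (p ∈? σ t) (λ _ → ≤-refl)) ⟩
    Σₗ is early * K               ≡⟨ *-comm (Σₗ is early) K ⟩
    K * Σₗ is early               ≡⟨ Σₗ-* is K early ⟨
    Σₗ is (λ i → K * early i)     ≤⟨ Σₗ-mono is each ⟩
    Σₗ is (λ i → L * late i)      ≡⟨ Σₗ-* is L late ⟩
    L * Σₗ is late                ≡⟨ *-comm L (Σₗ is late) ⟩
    waiting R σ s p * L           ∎
    where
    open ≤-Reasoning
    is = allFin (count R p)
    K L : ℕ
    K = suc s ∸ o (t , p)
    L = suc t ∸ o (t , p)
    early late : Fin (count R p) → ℕ
    early i = 𝟙 (early? t p i) * (t ∸ a p i)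
    late  i = 𝟙 (outstanding? R σ s p i) * (s ∸ a p i)
    exchange : ∀ x y z → x * (y * z) ≡ y * (z * x)
    exchange = solve-∀
    each : ∀ i → K * early i ≤ L * late i
    each i = begin
      K * (𝟙 (early? t p i) * (t ∸ a p i))   ≡⟨ exchange K (𝟙 (early? t p i)) (t ∸ a p i) ⟩
      𝟙 (early? t p i) * ((t ∸ a p i) * K)
        ≤⟨ 𝟙*-≤ (early? t p i) (λ (out , a<o) → ≤-trans (ramp a<o o≤s s≤t)
          (≤-𝟙* (outstanding? R σ s p i) ((s ∸ a p i) * L) (outstanding-earlier R s≤t (<-≤-trans a<o o≤s) out))) ⟩
      𝟙 (outstanding? R σ s p i) * ((s ∸ a p i) * L)
        ≡⟨ exchange L (𝟙 (outstanding? R σ s p i)) (s ∸ a p i) ⟨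
      L * late i                                       ∎

  -- A request counted in `X` waits from before `s` until `t`, so LWF does not broadcast `p` at `s`.
  -- It broadcasts four other pages, each with at least the waiting time of `p`.
  busy : ∀ {y e s} → 0 < y → e ∈ events → Covers y s e → 4 ≤ #heavy y s
  busy {y} {t , p} {s} 0<y _ (o≤s , s<t , y*≤) = begin
    4                                     ≤⟨ saturated R lwf out p∉ ⟩
    ∣ σ s ∣                               ≡⟨ ∣∣≡Σₗ (σ s) ⟩
    Σₗ (allFin n) (λ q → 𝟙 (q ∈? σ s))
      ≤⟨ Σₗ-mono (allFin n) (λ q → 𝟙-mono (q ∈? σ s) (heavy? y s q) (λ q∈ → q∈ , y≤ q∈)) ⟩
    #heavy y s                            ∎
    where
    open ≤-Reasoning
    L : ℕ
    L = suc t ∸ o (t , p)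
    0<L : 0 < L
    0<L = m<n⇒0<n∸m (s≤s (≤-trans o≤s (<⇒≤ s<t)))
    0<X : 0 < X (t , p)
    0<X = n≢0⇒n>0 λ X≡0 → <⇒≱ (*-mono-< 0<y 0<L) (≤-trans y*≤ (≤-reflexive
      (trans (cong (λ x → 200 * x * (suc s ∸ o (t , p))) X≡0) refl)))
    witness = proj₂ (X-witness 0<X)
    i = proj₁ witness
    a<s : a p i < s
    a<s = <-≤-trans (proj₂ (proj₂ witness)) o≤s
    out : Outstanding R σ s p i
    out = outstanding-earlier R (<⇒≤ s<t) a<s (proj₁ (proj₂ witness))
    p∉ : p ∉ₛ σ s
    p∉ = proj₂ (proj₁ (proj₂ witness)) s<t a<s
    y≤200w : y ≤ 200 * waiting R σ s p
    y≤200w = *-cancelʳ-≤ y _ L {{>-nonZero 0<L}} (begin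
      y * L                                         ≤⟨ y*≤ ⟩
      200 * X (t , p) * (suc s ∸ o (t , p))         ≡⟨ *-assoc 200 (X (t , p)) (suc s ∸ o (t , p)) ⟩
      200 * (X (t , p) * (suc s ∸ o (t , p)))       ≤⟨ *-monoʳ-≤ 200 (X-ramp o≤s (<⇒≤ s<t)) ⟩
      200 * (waiting R σ s p * L)                   ≡⟨ *-assoc 200 (waiting R σ s p) L ⟨
      200 * waiting R σ s p * L                     ∎)
    y≤ : ∀ {q} → q ∈ₛ σ s → y ≤ 200 * waiting R σ s q
    y≤ {q} q∈ = ≤-trans y≤200w (*-monoʳ-≤ 200
      (subst₂ _≤_ (waitingTime≡waiting R σ s p) (waitingTime≡waiting R σ s q) (longest q∈ p∉)))

  own : ∀ {y e} → 0 < y → e ∈ events → y ≤ 100 * X e → 1 ≤ #heavy y (b e)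
  own {y} {t , p} 0<y _ y≤ = ≤-trans (≤-reflexive (sym (𝟙-yes (heavy? y t p) (p∈ , y≤200w))))
    (∈⇒≤Σₗ (λ p → 𝟙 (heavy? y t p)) (∈-allFin p))
    where
    0<X : 0 < X (t , p)
    0<X = n≢0⇒n>0 λ X≡0 → <⇒≱ 0<y (≤-trans y≤ (≤-reflexive (cong (100 *_) X≡0)))
    p∈ : p ∈ₛ σ t
    p∈ = proj₁ (X-witness 0<X)
    X≤w : X (t , p) ≤ waiting R σ t p
    X≤w = 𝟙*-≤ (p ∈? σ t) λ _ → Σₗ-mono (allFin (count R p)) λ i →
      *-monoˡ-≤ (t ∸ a p i) (𝟙-mono (early? t p i) (outstanding? R σ t p i) proj₁)
    y≤200w : y ≤ 200 * waiting R σ t p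
    y≤200w = ≤-trans y≤ (*-mono-≤ (≤ᵇ⇒≤ 100 200 _) X≤w)

  -- Flow times as sums over broadcasts

  served : ℕ → (p : Fin n) → Fin (count R p) → ℕ
  served t p i = 𝟙 (p ∈? σ t) * (𝟙 (outstanding? R σ t p i) * (t ∸ a p i))

  finish-unique : ∀ {t p i} → p ∈ₛ σ t → Outstanding R σ t p i → t ≡ f p i
  finish-unique {t} {p} {i} p∈ (a<t , unserved) = ≤-antisym
    (≮⇒≥ (λ f<t → unserved f<t (IsFinishTime.after (finish p i)) (IsFinishTime.broadcast (finish p i))))
    (IsFinishTime.earliest (finish p i) a<t p∈)

  -- A request contributes only at its own finish time, and there its flow time.
  Σ-served : Σₗ times (λ t → Σᵣ R (served t)) ≤ Σᵣ R flow
  Σ-served = ≤-trans (≤-reflexive (Σᵣ-swap R times served)) (Σᵣ-mono R once)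
    where
    when : ∀ {p i} t → 0 < served t p i → t ≡ f p i
    when {p} {i} t 0<s = let p∈ , 0<s′ = 𝟙*-positive (p ∈? σ t) 0<s in
      finish-unique p∈ (proj₁ (𝟙*-positive (outstanding? R σ t p i) 0<s′))
    once : ∀ p i → Σₗ times (λ t → served t p i) ≤ flow p i
    once p i = Σₗ-single (range-unique 0 (suc T))
      (λ {s} {t} hs ht → trans (when s hs) (sym (when t ht)))
      (λ t → 𝟙*-≤ (p ∈? σ t) λ p∈ → 𝟙*-≤ (outstanding? R σ t p i) λ out →
        ≤-reflexive (cong (_∸ a p i) (finish-unique p∈ out)))

  -- A broadcast with waiting time F is heavy only at the levels from 1 to 200F.
  Σ-heavy : ∀ Y → Σₗ (range 1 Y) (λ y → Σₗ times (#heavy y)) ≤ 200 * Σᵣ R flow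
  Σ-heavy Y = begin
    Σₗ (range 1 Y) (λ y → Σₗ times (λ t → Σₗ (allFin n) (λ p → 𝟙 (heavy? y t p))))
      ≡⟨ Σₗ-swap (range 1 Y) times #heavy ⟩
    Σₗ times (λ t → Σₗ (range 1 Y) (λ y → Σₗ (allFin n) (λ p → 𝟙 (heavy? y t p))))
      ≡⟨ Σₗ-cong times (λ t → Σₗ-swap (range 1 Y) (allFin n) (λ y p → 𝟙 (heavy? y t p))) ⟩
    Σₗ times (λ t → Σₗ (allFin n) (λ p → Σₗ (range 1 Y) (λ y → 𝟙 (heavy? y t p))))
      ≤⟨ Σₗ-mono times (λ t → ≤-trans (Σₗ-mono (allFin n) (levels≤ t))
           (≤-reflexive (Σₗ-* (allFin n) 200 (λ p → Σₗ (allFin (count R p)) (served t p))))) ⟩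
    Σₗ times (λ t → 200 * Σᵣ R (served t))
      ≡⟨ Σₗ-* times 200 (λ t → Σᵣ R (served t)) ⟩
    200 * Σₗ times (λ t → Σᵣ R (served t))
      ≤⟨ *-monoʳ-≤ 200 Σ-served ⟩
    200 * Σᵣ R flow ∎
    where
    open ≤-Reasoning
    levels≤ : ∀ t p → Σₗ (range 1 Y) (λ y → 𝟙 (heavy? y t p)) ≤ 200 * Σₗ (allFin (count R p)) (served t p)
    levels≤ t p = by-cases (p ∈? σ t)
      where
      by-cases : Dec (p ∈ₛ σ t) →
                 Σₗ (range 1 Y) (λ y → 𝟙 (heavy? y t p)) ≤ 200 * Σₗ (allFin (count R p)) (served t p)
      by-cases (no p∉) = ≤-trans
        (Σₗ-mono (range 1 Y) {g = λ _ → 0} (λ y → ≤-reflexive (𝟙-no (heavy? y t p) (p∉ ∘ proj₁))))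
        (≤-trans (≤-reflexive (Σₗ-zero (range 1 Y))) z≤n)
      by-cases (yes p∈) = begin
        Σₗ (range 1 Y) (λ y → 𝟙 (heavy? y t p))
          ≤⟨ Σₗ-mono (range 1 Y) (λ y → 𝟙-mono (heavy? y t p) (y ≤? 200 * waiting R σ t p) proj₂) ⟩
        Σₗ (range 1 Y) (λ y → 𝟙 (y ≤? 200 * waiting R σ t p))
          ≤⟨ count-≤ (200 * waiting R σ t p) 0 Y ⟩
        200 * waiting R σ t p
          ≤⟨ *-monoʳ-≤ 200 (Σₗ-mono (allFin (count R p)) (λ i → ≤-𝟙* (p ∈? σ t) _ p∈)) ⟩
        200 * Σₗ (allFin (count R p)) (served t p) ∎

  overtaken : ℕ → (p : Fin n) → Fin (count R p) → ℕ
  overtaken t p i = 𝟙 (p ∈? σ t) * (𝟙 (early? t p i) * (t ∸ a p i))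

  Σ-overtaken : Σᵣ R (λ p i → Σₗ times (λ t → overtaken t p i)) ≡ Σₗ events X
  Σ-overtaken = begin
    Σᵣ R (λ p i → Σₗ times (λ t → overtaken t p i))    ≡⟨ Σᵣ-swap R times overtaken ⟨
    Σₗ times (λ t → Σᵣ R (overtaken t))                ≡⟨ Σₗ-cong times (λ t → Σₗ-cong (allFin n) (λ p →
           Σₗ-* (allFin (count R p)) (𝟙 (p ∈? σ t)) (λ i → 𝟙 (early? t p i) * (t ∸ a p i)))) ⟩
    Σₗ times (λ t → Σₗ (allFin n) (λ p → X (t , p)))   ≡⟨ Σₗ-cartesianProduct times (allFin n) X ⟨
    Σₗ events X                                        ∎
    where open ≡-Reasoning

  -- If f* < f, then a < f* ≤ o for the last broadcast `o` by `σ*` before f, so the whole flow time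
  -- of the request is part of `X` at f.
  flow-split : Σᵣ R flow ≤ Σᵣ R flow* + Σₗ events X
  flow-split = begin
    Σᵣ R flow                                                        ≤⟨ Σᵣ-mono R each ⟩
    Σᵣ R (λ p i → flow* p i + Σₗ times (λ t → overtaken t p i))
      ≡⟨ Σᵣ-+ R flow* (λ p i → Σₗ times (λ t → overtaken t p i)) ⟩
    Σᵣ R flow* + Σᵣ R (λ p i → Σₗ times (λ t → overtaken t p i))
      ≡⟨ cong (Σᵣ R flow* +_) Σ-overtaken ⟩
    Σᵣ R flow* + Σₗ events X                                         ∎
    where
    open ≤-Reasoning
    each : ∀ p i → flow p i ≤ flow* p i + Σₗ times (λ t → overtaken t p i)
    each p i with f* p i <? f p i
    ... | no f*≮f = ≤-trans (∸-monoˡ-≤ (a p i) (≮⇒≥ f*≮f)) (m≤m+n _ _)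
    ... | yes f*<f = begin
      flow p i                               ≤⟨ ≤-𝟙* (early? t p i) (t ∸ a p i) (out , a<o) ⟩
      𝟙 (early? t p i) * (t ∸ a p i)         ≤⟨ ≤-𝟙* (p ∈? σ t) _ broadcast ⟩
      overtaken t p i
        ≤⟨ ∈⇒≤Σₗ (λ t → overtaken t p i) (∈-range⁺ z≤n (s≤s (≤Σᵣ R f p i))) ⟩
      Σₗ times (λ t → overtaken t p i)       ≤⟨ m≤n+m _ (flow* p i) ⟩
      flow* p i + Σₗ times (λ t → overtaken t p i) ∎
      where
      open IsFinishTime (finish p i)
      module * = IsFinishTime (finish* p i)
      t : ℕ
      t = f p i
      out : Outstanding R σ t p i
      out = after , λ u<t a<u p∈ → <⇒≱ u<t (earliest a<u p∈)
      a<o : a p i < o (t , p)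
      a<o = <-≤-trans *.after (lastBefore-upper σ* p t f*<f *.broadcast)

  competitive : Σᵣ R flow ≤ 4312 * Σᵣ R flow*
  competitive = absorb {O = Σᵣ R flow*} {X = Σₗ events X} flow-split
    (charging T #heavy
      (λ e∈ → s≤s⁻¹ (proj₂ (∈-range⁻ (suc T) (proj₁ (∈-cartesianProduct⁻ times (allFin n) e∈)))))
      busy own)
    (Σ-heavy (100 * Σₗ events X))

theoremA1 : ∃[ C ] (∀ (n : ℕ) (R : Requests n) (σ : Schedule n) → IsLWF R 4 σ →
    ∀ (opt : ℕ) → IsOPT R opt →
    ∃[ lwf ] (TotalFlow R σ lwf × lwf ≤ C * opt))
theoremA1 = 4312 , λ n R σ lwf opt isOPT →
  let σ* , speed* , f* , finish* , opt≡ = IsOPT.attained isOPT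
      -- `TotalFlow` requires every request to be finished; for LWF this is derived rather than
      -- assumed.
      f = λ p i → proj₁ (lwf-finishes R lwf p i)
      finish = λ p i → proj₂ (lwf-finishes R lwf p i)
  in _ , (f , finish , refl) , subst₂ _≤_
       (sym (sum≡Σᵣ R (λ p i → f p i ∸ arrival R p i)))
       (cong (4312 *_) (sym (trans opt≡ (sum≡Σᵣ R (λ p i → f* p i ∸ arrival R p i)))))
       (Competitive.competitive R lwf speed* finish finish*)
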